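{- Let $E$ be an elliptic curve over $\mathbb{Q}$ such that $E(\mathbb{Q})[5]\neq\{0\}$. Assume moreover that the conductor of $E$ is $N_E=p^{\alpha}q^{\beta}$, where $p\neq q$ are primes and $\alpha,\beta>0$ are integers. Then, up to interchanging the names of $p$ and $q$, the absolute value $|\Delta_E|$ of the minimal discriminant is one of the following: $$2^5\cdot 5^2,\quad 2^{15}\cdot 5^2,\quad 3^5\cdot 5^2,\quad 13^5\cdot 5^2,\quad 37^5\cdot 31^2,\quad 7^5\cdot 5^3,\quad p^{5k}q^{2l+1}\ \text{ for some integers } k,l\ge 0.$$
   Context: For an elliptic curve $E/\mathbb{Q}$, $\Delta_E$ denotes its minimal discriminant and $N_E$ its conductor; these have the same prime divisors. $E(\mathbb{Q})[5]$ is the subgroup of points of $E(\mathbb{Q})$ killed by multiplication by $5$. -}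

module Defs where

open import Algebra.Bundles.Raw using (RawRing)
import Algebra.Definitions.RawSemiring as RawSemiringOps
open import Data.Integer.Base as ℤ using (ℤ; ∣_∣)
import Data.Integer.Divisibility as ℤ
open import Data.Nat.Base as ℕ using (ℕ; zero; suc; _≤_)
open import Data.Nat.Divisibility using (_∣_; _∤_)
open import Data.Nat.Primality using (Prime)
open import Data.Product.Base using (Σ-syntax; ∃-syntax; _×_; _,_)
open import Data.Rational.Base as ℚ using (ℚ; 0ℚ)
import Data.Rational.Properties as ℚₚ
open import Data.Sum.Base using (_⊎_)
open import Level using (0ℓ)
open import Relation.Binary.PropositionalEquality using (_≡_; _≢_)
open import Relation.Nullary using (¬_; yes; no)

------------------------------------------------------------------------
-- Weierstrass equations  y² + a₁xy + a₃y = x³ + a₂x² + a₄x + a₆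

record Weierstrass (A : Set) : Set where
  constructor ⟨_,_,_,_,_⟩
  field a₁ a₂ a₃ a₄ a₆ : A

map : {A B : Set} → (A → B) → Weierstrass A → Weierstrass B
map f ⟨ a₁ , a₂ , a₃ , a₄ , a₆ ⟩ = ⟨ f a₁ , f a₂ , f a₃ , f a₄ , f a₆ ⟩

module Invariants (R : RawRing 0ℓ 0ℓ) where
  open RawRing R
  open RawSemiringOps rawSemiring using () renaming (_×′_ to _·_)

  private
    infixl 6 _-_
    _-_ : Carrier → Carrier → Carrier
    x - y = x + (- y)

  module _ (W : Weierstrass Carrier) where
    open Weierstrass W

    b₂ b₄ b₆ b₈ c₄ Δ : Carrier
    b₂ = a₁ * a₁ + 4 · a₂
    b₄ = 2 · a₄ + a₁ * a₃
    b₆ = a₃ * a₃ + 4 · a₆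
    b₈ = a₁ * a₁ * a₆ + 4 · (a₂ * a₆) - a₁ * a₃ * a₄ + a₂ * a₃ * a₃ - a₄ * a₄
    c₄ = b₂ * b₂ - 24 · b₄
    Δ  = 9 · (b₂ * b₄ * b₆) - b₂ * b₂ * b₈ - 8 · (b₄ * b₄ * b₄) - 27 · (b₆ * b₆)

  -- The equation satisfied by (x′ , y′), where x = x′ + r, y = y′ + s x′ + t.
  translate : (r s t : Carrier) → Weierstrass Carrier → Weierstrass Carrier
  translate r s t ⟨ a₁ , a₂ , a₃ , a₄ , a₆ ⟩ =
    ⟨ a₁ + 2 · s
    , a₂ - s * a₁ + 3 · r - s * s
    , a₃ + r * a₁ + 2 · t
    , a₄ - s * a₃ + 2 · (r * a₂) - (t + r * s) * a₁ + 3 · (r * r) - 2 · (s * t)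
    , a₆ + r * a₄ + r * r * a₂ + r * r * r - t * a₃ - t * t - r * t * a₁
    ⟩

  -- The equation satisfied by (u²x , u³y).
  scale : Carrier → Weierstrass Carrier → Weierstrass Carrier
  scale u ⟨ a₁ , a₂ , a₃ , a₄ , a₆ ⟩ =
    ⟨ u * a₁ , u² * a₂ , u² * u * a₃ , u² * u² * a₄ , u² * u² * u² * a₆ ⟩
    where u² = u * u

module ℤW = Invariants ℤ.+-*-rawRing
module ℚW = Invariants ℚ.+-*-rawRing

record EllipticCurve : Set where
  field
    equation    : Weierstrass ℚ
    nonsingular : ℚW.Δ equation ≢ 0ℚ
  open Weierstrass equation public

------------------------------------------------------------------------
-- The group E(ℚ)

data Point : Set where
  O   : Point
  aff : (x y : ℚ) → Point

module _ (E : EllipticCurve) where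
  open EllipticCurve E
  open import Data.Rational.Base using (_+_; _-_; _*_; -_; _÷_)

  data OnCurve : Point → Set where
    O   : OnCurve O
    aff : ∀ {x y} →
          y * y + a₁ * x * y + a₃ * y ≡ x * x * x + a₂ * x * x + a₄ * x + a₆ →
          OnCurve (aff x y)

  -- The third intersection point of the line y = m x + c with the curve has
  -- abscissa x₃; its negative is the sum of the other two.
  chord : (m x₁ y₁ x₂ : ℚ) → Point
  chord m x₁ y₁ x₂ = aff x₃ (- (m + a₁) * x₃ - c - a₃)
    where
    x₃ = m * m + a₁ * m - a₂ - x₁ - x₂
    c  = y₁ - m * x₁

  -- The group law, meaningful for points satisfying OnCurve.  Two such points
  -- with x₁ ≡ x₂ are opposite exactly when y₁ + y₂ + a₁x₁ + a₃ vanishes;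
  -- otherwise they are equal, this quantity is 2y₁ + a₁x₁ + a₃, and the line
  -- through them is the tangent.
  infixl 6 _⊕_
  _⊕_ : Point → Point → Point
  O         ⊕ Q         = Q
  aff x₁ y₁ ⊕ O         = aff x₁ y₁
  aff x₁ y₁ ⊕ aff x₂ y₂ with x₂ - x₁ ℚₚ.≟ 0ℚ | y₁ + y₂ + a₁ * x₁ + a₃ ℚₚ.≟ 0ℚ
  ... | no e≢0 | _      =
    chord (((y₂ - y₁) ÷ (x₂ - x₁)) {{ℚ.≢-nonZero e≢0}}) x₁ y₁ x₂
  ... | yes _  | yes _  = O
  ... | yes _  | no d≢0 =
    chord (((three * x₁ * x₁ + two * a₂ * x₁ + a₄ - a₁ * y₁)
             ÷ (y₁ + y₂ + a₁ * x₁ + a₃)) {{ℚ.≢-nonZero d≢0}}) x₁ y₁ x₂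
    where
    two three : ℚ
    two   = ℤ.+ 2 ℚ./ 1
    three = ℤ.+ 3 ℚ./ 1

  infixr 7 _•_
  _•_ : ℕ → Point → Point
  zero  • P = O
  suc n • P = P ⊕ n • P

  -- E(ℚ)[n] ≠ {0}
  NontrivialTorsion : ℕ → Set
  NontrivialTorsion n = ∃[ P ] OnCurve P × n • P ≡ O × P ≢ O

------------------------------------------------------------------------
-- Minimal models

infix 4 _≅_
_≅_ : Weierstrass ℚ → Weierstrass ℚ → Set
W ≅ W′ = ∃[ u ] ∃[ r ] ∃[ s ] ∃[ t ]
  u ≢ 0ℚ × ℚW.scale u W′ ≡ ℚW.translate r s t W

IntegralModel : EllipticCurve → Weierstrass ℤ → Set
IntegralModel E W = EllipticCurve.equation E ≅ map (ℚ._/ 1) W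

IsMinimalModel : EllipticCurve → Weierstrass ℤ → Set
IsMinimalModel E W = IntegralModel E W ×
  (∀ W′ → IntegralModel E W′ → ∣ ℤW.Δ W ∣ ≤ ∣ ℤW.Δ W′ ∣)

IsMinimalDiscriminant : EllipticCurve → ℤ → Set
IsMinimalDiscriminant E D = ∃[ W ] IsMinimalModel E W × ℤW.Δ W ≡ D

------------------------------------------------------------------------
-- The conductor

-- v is the p-adic valuation of n.
_hasValuation_at_ : ℕ → ℕ → ℕ → Set
n hasValuation v at p = p ℕ.^ v ∣ n × p ℕ.^ suc v ∤ n

-- Some integral translate of W has aᵢ divisible by p ^ eᵢ for each i.
Reaches : ℕ → Weierstrass ℤ → (e₁ e₂ e₃ e₄ e₆ : ℕ) → Set
Reaches p W e₁ e₂ e₃ e₄ e₆ = ∃[ r ] ∃[ s ] ∃[ t ]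
  let open Weierstrass (ℤW.translate r s t W) in
    ℤ.+ (p ℕ.^ e₁) ℤ.∣ a₁ × ℤ.+ (p ℕ.^ e₂) ℤ.∣ a₂ × ℤ.+ (p ℕ.^ e₃) ℤ.∣ a₃ ×
    ℤ.+ (p ℕ.^ e₄) ℤ.∣ a₄ × ℤ.+ (p ℕ.^ e₆) ℤ.∣ a₆

-- AdditiveFibre p W m: the geometric special fibre at p of the minimal proper
-- regular model has m irreducible components, where W is minimal at p with
-- additive reduction.  This is Tate's algorithm; the constructors are named
-- by Kodaira symbol.  At each stage the algorithm asks whether a quadratic or
-- cubic over 𝔽ₚ has a multiple root; since that root is rational, it can be
-- translated to 0, so the answer is yes iff the next row of divisibilities is
-- reached.  I*odd k is of type I*₂ₖ₋₃, and I*even k of type I*₂ₖ₋₂.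
data AdditiveFibre (p : ℕ) (W : Weierstrass ℤ) : ℕ → Set where
  II     : Reaches p W 1 1 1 1 1 → ¬ Reaches p W 1 1 1 1 2 → AdditiveFibre p W 1
  III    : Reaches p W 1 1 1 1 2 → ¬ Reaches p W 1 1 1 2 2 → AdditiveFibre p W 2
  IV     : Reaches p W 1 1 1 2 2 → ¬ Reaches p W 1 1 2 2 3 → AdditiveFibre p W 3
  I*₀    : Reaches p W 1 1 2 2 3 → ¬ Reaches p W 1 1 2 3 4 → AdditiveFibre p W 5
  I*odd  : ∀ k → 2 ≤ k →
           Reaches p W 1 1 k (1 ℕ.+ k) (2 ℕ.* k) →
           ¬ Reaches p W 1 1 (1 ℕ.+ k) (1 ℕ.+ k) (1 ℕ.+ 2 ℕ.* k) →
           ¬ Reaches p W 1 2 2 3 4 →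
           AdditiveFibre p W (2 ℕ.+ 2 ℕ.* k)
  I*even : ∀ k → 2 ≤ k →
           Reaches p W 1 1 (1 ℕ.+ k) (1 ℕ.+ k) (1 ℕ.+ 2 ℕ.* k) →
           ¬ Reaches p W 1 1 (1 ℕ.+ k) (2 ℕ.+ k) (2 ℕ.+ 2 ℕ.* k) →
           ¬ Reaches p W 1 2 2 3 4 →
           AdditiveFibre p W (3 ℕ.+ 2 ℕ.* k)
  IV*    : Reaches p W 1 2 2 3 4 → ¬ Reaches p W 1 2 3 3 5 → AdditiveFibre p W 7
  III*   : Reaches p W 1 2 3 3 5 → ¬ Reaches p W 1 2 3 4 5 → AdditiveFibre p W 8
  II*    : Reaches p W 1 2 3 4 5 → ¬ Reaches p W 1 2 3 4 6 → AdditiveFibre p W 9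

-- The exponent of the conductor at p, where W is minimal at p.  The exponent
-- in the additive case is 2 + δ, with δ the wild part, which is read off from
-- Ogg's formula  v(Δ) = 2 + δ + m - 1.
data ConductorExponent (p : ℕ) (W : Weierstrass ℤ) : ℕ → Set where
  good           : ¬ (ℤ.+ p ℤ.∣ ℤW.Δ W) → ConductorExponent p W 0
  multiplicative : ℤ.+ p ℤ.∣ ℤW.Δ W → ¬ (ℤ.+ p ℤ.∣ ℤW.c₄ W) → ConductorExponent p W 1
  additive       : ∀ m δ → ℤ.+ p ℤ.∣ ℤW.Δ W → ℤ.+ p ℤ.∣ ℤW.c₄ W →
                   AdditiveFibre p W m →
                   ∣ ℤW.Δ W ∣ hasValuation (1 ℕ.+ δ ℕ.+ m) at p →
                   ConductorExponent p W (2 ℕ.+ δ)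

IsConductor : EllipticCurve → ℕ → Set
IsConductor E N = Σ[ W ∈ Weierstrass ℤ ] IsMinimalModel E W ×
  (∀ p → Prime p → ∃[ f ] ConductorExponent p W f × N hasValuation f at p)

------------------------------------------------------------------------

DiscriminantShape : (p q D : ℕ) → Set
DiscriminantShape p q D =
    D ≡ 2 ^ 5 * 5 ^ 2
  ⊎ D ≡ 2 ^ 15 * 5 ^ 2
  ⊎ D ≡ 3 ^ 5 * 5 ^ 2
  ⊎ D ≡ 13 ^ 5 * 5 ^ 2
  ⊎ D ≡ 37 ^ 5 * 31 ^ 2
  ⊎ D ≡ 7 ^ 5 * 5 ^ 3
  ⊎ (∃[ k ] ∃[ l ] D ≡ p ^ (5 * k) * q ^ (2 * l + 1))
  where open import Data.Nat.Base using (_+_; _*_; _^_)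

{-# OPTIONS --safe #-}

-- Move a point P of order 5 to (0 , 0) and its tangent to y = 0.  Writing out 4P = - P
-- then shows that E is y² + (b - a)xy - ab²y = x³ - abx² with a, b rational, and a
-- scaling makes a, b coprime integers.  For this model Δ = a⁵b⁵Q with
-- Q = a² - 11ab - b², and c₄ ≡ 5a²b² modulo Q, so at most the prime 5 divides both Δ
-- and c₄, and then 5⁴ ∤ Δ.  Hence the model is minimal and |Δ| = |a|⁵|b|⁵|Q|, whose
-- factors are pairwise coprime.  By (a , b) ↦ (- b , a), which changes Q to - Q, there
-- are two cases.
--   * b = ± 1, |a| a power of p, |Q| a power of q.  If |Q| = z², then
--     (2a - 11b)² ∓ 4z² = 125, which has finitely many solutions.
--   * Q = ± 1, |a| a power of p, |b| a power of q.  If both are squares, one of them is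
--     even by reduction modulo 8, hence a power 4ⁿ; completing the square gives
--     Y² = 125W² ± 1 with W = 2²ⁿ⁻¹, which factors as k(k + 1) = 125·2ⁱ.

module Submission where

open import Defs
open import Algebra.Bundles using (RawRing)
import Data.Bool.Base as Bool
open import Data.Empty using (⊥)
open import Data.Fin.Base as Fin using (Fin)
open import Data.Integer.Base as ℤ using (ℤ; ∣_∣)
import Data.Integer.Divisibility.Signed as ℤS
import Data.Integer.Properties as ℤₚ
open import Data.List.Base using ([]; _∷_)
open import Data.List.Relation.Unary.All using (All; _∷_)
open import Data.Maybe.Base using (Maybe; is-just; just; nothing)
open import Data.Nat.Base as ℕ using (ℕ; zero; suc)
import Data.Nat.Coprimality as Coprimality
open import Data.Nat.Coprimality using (Coprime)
open import Data.Nat.Divisibility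
open import Data.Nat.ListAction using (product)
open import Data.Nat.Primality
open import Data.Nat.Primality.Factorisation using (factorise; module PrimeFactorisation)
import Data.Nat.Properties as ℕₚ
open import Data.Nat.Tactic.RingSolver using (solve-∀)
open import Data.Product.Base using (∃-syntax; _×_; _,_; proj₁; proj₂)
open import Data.Rational.Base as ℚ using (ℚ; 0ℚ; 1ℚ)
import Data.Rational.Properties as ℚₚ
import Data.Rational.Unnormalised.Base as ℚᵘ
import Data.Rational.Unnormalised.Properties as ℚᵘₚ
import Data.Sum.Base as ⊎
open import Data.Sum.Base using (_⊎_; inj₁; inj₂; [_,_]′)
open import Data.Vec.Base as Vec using (Vec; []; _∷_)
import Data.Vec.Properties as Vecₚ
open import Function.Base using (_⟨_⟩_; _∘_; id)
open import Level using (0ℓ)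
open import Relation.Binary.PropositionalEquality
open import Relation.Nullary using (¬_; yes; no; contradiction)
open import Relation.Nullary.Decidable using (from-yes; from-no; _×-dec_; _⊎-dec_; _→-dec_)
open import Tactic.RingSolver.Core.AlmostCommutativeRing
  using (AlmostCommutativeRing; fromCommutativeRing; -raw-almostCommutative⟶)
import Tactic.RingSolver.Core.Expression as Expression
open import Tactic.RingSolver.Core.Expression using (Expr; Κ; Ι; _⊛_)
  renaming (_⊕_ to _:+_; _⊗_ to _:*_; ⊝_ to :-_)
open import Tactic.RingSolver.Core.Polynomial.Parameters using (RawCoeff; Homomorphism)

-- The embedding of the integers in the rationals

ι : ℤ → ℚ
ι = ℚ._/ 1

ι-toℚᵘ : ∀ i → ℚ.toℚᵘ (ι i) ℚᵘ.≃ ℚᵘ.mkℚᵘ i 0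
ι-toℚᵘ i = ℚₚ.toℚᵘ-fromℚᵘ (ℚᵘ.mkℚᵘ i 0)

-- Unnormalised fractions are compared by cross-multiplication, so the arithmetic of the embedding
-- needs no greatest common divisors.
ι-via : ∀ i {x} → ℚ.toℚᵘ x ℚᵘ.≃ ℚᵘ.mkℚᵘ i 0 → ι i ≡ x
ι-via i eq = ℚₚ.toℚᵘ-injective (ℚᵘₚ.≃-trans (ι-toℚᵘ i) (ℚᵘₚ.≃-sym eq))

ι-+ : ∀ i j → ι (i ℤ.+ j) ≡ ι i ℚ.+ ι j
ι-+ i j = ι-via (i ℤ.+ j) (ℚᵘₚ.≃-trans (ℚₚ.toℚᵘ-homo-+ (ι i) (ι j))
  (ℚᵘₚ.≃-trans (ℚᵘₚ.+-cong (ι-toℚᵘ i) (ι-toℚᵘ j))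
    (ℚᵘ.*≡* (cong (ℤ._* ℤ.1ℤ) (cong₂ ℤ._+_ (ℤₚ.*-identityʳ i) (ℤₚ.*-identityʳ j))))))

ι-* : ∀ i j → ι (i ℤ.* j) ≡ ι i ℚ.* ι j
ι-* i j = ι-via (i ℤ.* j) (ℚᵘₚ.≃-trans (ℚₚ.toℚᵘ-homo-* (ι i) (ι j))
  (ℚᵘₚ.*-cong (ι-toℚᵘ i) (ι-toℚᵘ j)))

ι-neg : ∀ i → ι (ℤ.- i) ≡ ℚ.- ι i
ι-neg i = ι-via (ℤ.- i) (ℚᵘₚ.≃-trans (ℚₚ.toℚᵘ-homo‿- (ι i)) (ℚᵘₚ.-‿cong (ι-toℚᵘ i)))

ι-injective : ∀ {i j} → ι i ≡ ι j → i ≡ j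
ι-injective {i} {j} eq with ℚₚ.fromℚᵘ-injective {ℚᵘ.mkℚᵘ i 0} {ℚᵘ.mkℚᵘ j 0} eq
... | ℚᵘ.*≡* eq′ = ℤₚ.*-cancelʳ-≡ i j ℤ.1ℤ eq′

-- Polynomial identities with integer coefficients

ℤCoeff : RawCoeff 0ℓ 0ℓ
ℤCoeff = record { rawRing = ℤ.+-*-rawRing ; isZero = λ i → is-just (zero? i) }
  where
  zero? : (i : ℤ) → Maybe (ℤ.0ℤ ≡ i)
  zero? ℤ.+0 = just refl
  zero? _    = nothing

isZero⇒0≡ : ∀ i → Bool.T (RawCoeff.isZero ℤCoeff i) → ℤ.0ℤ ≡ i
isZero⇒0≡ ℤ.+0 _ = refl

ℤ-hom : Homomorphism 0ℓ 0ℓ 0ℓ 0ℓ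
ℤ-hom = record
  { from = ℤCoeff
  ; to = ring
  ; morphism = -raw-almostCommutative⟶ ring
  ; Zero-C⟶Zero-R = isZero⇒0≡
  }
  where
  ring : AlmostCommutativeRing 0ℓ 0ℓ
  ring = fromCommutativeRing ℤₚ.+-*-commutativeRing λ _ → nothing

ℚ-hom : Homomorphism 0ℓ 0ℓ 0ℓ 0ℓ
ℚ-hom = record
  { from = ℤCoeff
  ; to = fromCommutativeRing ℚₚ.+-*-commutativeRing λ _ → nothing
  ; morphism = record
    { ⟦_⟧ = ι ; +-homo = ι-+ ; *-homo = ι-* ; -‿homo = ι-neg ; 0-homo = refl ; 1-homo = refl }
  ; Zero-C⟶Zero-R = λ i p → cong ι (isZero⇒0≡ i p)
  }

-- Comparing normal forms before evaluation is much cheaper than Tactic.RingSolver, and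
-- integer coefficients avoid reducing fractions.
module Normalise (H : Homomorphism 0ℓ 0ℓ 0ℓ 0ℓ) where
  open Homomorphism H renaming (trans to trans′; sym to sym′) hiding (refl; zero)
  open import Algebra.Properties.Semiring.Exp.TCOptimised semiring using (^-congˡ)
  open import Tactic.RingSolver.Core.Polynomial.Base from renaming (ι to ι′)
  open import Tactic.RingSolver.Core.Polynomial.Semantics H renaming (⟦_⟧ to ⟦_⟧ₚ)
  open import Tactic.RingSolver.Core.Polynomial.Homomorphism H
  open Expression.Eval rawRing ⟦_⟧ᵣ public

  normalise : ∀ {n} → Expr Raw.Carrier n → Poly n
  normalise (Κ x)    = κ x
  normalise (Ι x)    = ι′ x
  normalise (x :+ y) = normalise x ⊞ normalise y
  normalise (x :* y) = normalise x ⊠ normalise y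
  normalise (:- x)   = ⊟ normalise x
  normalise (x ⊛ i)  = normalise x ⊡ i

  correct : ∀ {n} (e : Expr Raw.Carrier n) ρ → ⟦ normalise e ⟧ₚ ρ ≈ ⟦ e ⟧ ρ
  correct (Κ x)    ρ = κ-hom x ρ
  correct (Ι x)    ρ = ι-hom x ρ
  correct (x :+ y) ρ = ⊞-hom (normalise x) (normalise y) ρ ⟨ trans′ ⟩ (correct x ρ ⟨ +-cong ⟩ correct y ρ)
  correct (x :* y) ρ = ⊠-hom (normalise x) (normalise y) ρ ⟨ trans′ ⟩ (correct x ρ ⟨ *-cong ⟩ correct y ρ)
  correct (:- x)   ρ = ⊟-hom (normalise x) ρ ⟨ trans′ ⟩ -‿cong (correct x ρ)
  correct (x ⊛ i)  ρ = ⊡-hom (normalise x) i ρ ⟨ trans′ ⟩ ^-congˡ i (correct x ρ)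

  identity : ∀ {n} (e f : Expr Raw.Carrier n) → normalise e ≡ normalise f →
             ∀ ρ → ⟦ e ⟧ ρ ≈ ⟦ f ⟧ ρ
  identity e f eq ρ = sym′ (correct e ρ) ⟨ trans′ ⟩
    (reflexive (cong (λ p → ⟦ p ⟧ₚ ρ) eq) ⟨ trans′ ⟩ correct f ρ)

module ℤN = Normalise ℤ-hom
module ℚN = Normalise ℚ-hom

-- The invariants over this ring are the quoted invariants.
polyRing : ℕ → RawRing 0ℓ 0ℓ
polyRing n = record
  { Carrier = Expr ℤ n ; _≈_ = _≡_ ; _+_ = _:+_ ; _*_ = _:*_ ; -_ = :-_
  ; 0# = Κ ℤ.0ℤ ; 1# = Κ ℤ.1ℤ }

-- One induction over expressions replaces a separate calculation for each invariant that has to be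
-- carried from ℤ to ℚ.
ι-⟦⟧ : ∀ {n} (e : Expr ℤ n) ρ → ι (ℤN.⟦ e ⟧ ρ) ≡ ℚN.⟦ e ⟧ (Vec.map ι ρ)
ι-⟦⟧ (Κ x)    ρ = refl
ι-⟦⟧ (Ι x)    ρ = sym (Vecₚ.lookup-map x ι ρ)
ι-⟦⟧ (e :+ f) ρ = trans (ι-+ (ℤN.⟦ e ⟧ ρ) (ℤN.⟦ f ⟧ ρ)) (cong₂ ℚ._+_ (ι-⟦⟧ e ρ) (ι-⟦⟧ f ρ))
ι-⟦⟧ (e :* f) ρ = trans (ι-* (ℤN.⟦ e ⟧ ρ) (ℤN.⟦ f ⟧ ρ)) (cong₂ ℚ._*_ (ι-⟦⟧ e ρ) (ι-⟦⟧ f ρ))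
ι-⟦⟧ (:- e)   ρ = trans (ι-neg (ℤN.⟦ e ⟧ ρ)) (cong (ℚ.-_) (ι-⟦⟧ e ρ))
ι-⟦⟧ (e ⊛ k)  ρ = power k
  where
  power : ∀ k → ι (ℤN.⟦ e ⊛ k ⟧ ρ) ≡ ℚN.⟦ e ⊛ k ⟧ (Vec.map ι ρ)
  -- Exponentiation has exponent 1 as a separate base case, without a leading factor 1, hence three
  -- clauses.
  power 0             = refl
  power 1             = ι-⟦⟧ e ρ
  power (suc (suc k)) = trans (ι-* (ℤN.⟦ e ⊛ suc k ⟧ ρ) (ℤN.⟦ e ⟧ ρ))
    (cong₂ ℚ._*_ (power (suc k)) (ι-⟦⟧ e ρ))

-- Invariants of Weierstrass equations

module PolyW {n : ℕ} = Invariants (polyRing n)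

infixl 6 _:-_
_:-_ : ∀ {n} → Expr ℤ n → Expr ℤ n → Expr ℤ n
e :- f = e :+ :- f

con : ∀ {n} → ℕ → Expr ℤ n
con k = Κ (ℤ.+ k)

pattern v0 = Ι Fin.zero
pattern v1 = Ι (Fin.suc Fin.zero)
pattern v2 = Ι (Fin.suc (Fin.suc Fin.zero))
pattern v3 = Ι (Fin.suc (Fin.suc (Fin.suc Fin.zero)))
pattern v4 = Ι (Fin.suc (Fin.suc (Fin.suc (Fin.suc Fin.zero))))
pattern v5 = Ι (Fin.suc (Fin.suc (Fin.suc (Fin.suc (Fin.suc Fin.zero)))))
pattern v6 = Ι (Fin.suc (Fin.suc (Fin.suc (Fin.suc (Fin.suc (Fin.suc Fin.zero))))))
pattern v7 = Ι (Fin.suc (Fin.suc (Fin.suc (Fin.suc (Fin.suc (Fin.suc (Fin.suc Fin.zero)))))))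
pattern v8 = Ι (Fin.suc (Fin.suc (Fin.suc (Fin.suc (Fin.suc (Fin.suc (Fin.suc (Fin.suc Fin.zero))))))))

genericW : ∀ {n} → Weierstrass (Expr ℤ (5 ℕ.+ n))
genericW = ⟨ v0 , v1 , v2 , v3 , v4 ⟩

-- The classical covariant with 1728 Δ = c₄³ - c₆². Its constants 36 and 216 are images of integers
-- rather than repeated sums.
module C₆ (R : RawRing 0ℓ 0ℓ) (ι : ℤ → RawRing.Carrier R) (W : Weierstrass (RawRing.Carrier R)) where
  open RawRing R
  open Invariants R

  c₆ : Carrier
  c₆ = ι (ℤ.+ 36) * (b₂ W * b₄ W) + - (b₂ W * b₂ W * b₂ W + ι (ℤ.+ 216) * b₆ W)

module ℚC = C₆ ℚ.+-*-rawRing ι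
module PolyC {n : ℕ} = C₆ (polyRing n) Κ

1728Δ : ∀ W → ι (ℤ.+ 1728) ℚ.* ℚW.Δ W ≡
        ℚW.c₄ W ℚ.* ℚW.c₄ W ℚ.* ℚW.c₄ W ℚ.- ℚC.c₆ W ℚ.* ℚC.c₆ W
1728Δ ⟨ a₁ , a₂ , a₃ , a₄ , a₆ ⟩ = ℚN.identity {5}
  (con 1728 :* PolyW.Δ genericW)
  (PolyW.c₄ genericW :* PolyW.c₄ genericW :* PolyW.c₄ genericW :-
    PolyC.c₆ genericW :* PolyC.c₆ genericW) refl
  (a₁ ∷ a₂ ∷ a₃ ∷ a₄ ∷ a₆ ∷ [])

c₄-translate : ∀ W r s t → ℚW.c₄ (ℚW.translate r s t W) ≡ ℚW.c₄ W
c₄-translate ⟨ a₁ , a₂ , a₃ , a₄ , a₆ ⟩ r s t = ℚN.identity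
  (PolyW.c₄ (PolyW.translate v5 v6 v7 genericW)) (PolyW.c₄ genericW) refl
  (a₁ ∷ a₂ ∷ a₃ ∷ a₄ ∷ a₆ ∷ r ∷ s ∷ t ∷ [])

c₆-translate : ∀ W r s t → ℚC.c₆ (ℚW.translate r s t W) ≡ ℚC.c₆ W
c₆-translate ⟨ a₁ , a₂ , a₃ , a₄ , a₆ ⟩ r s t = ℚN.identity
  (PolyC.c₆ (PolyW.translate v5 v6 v7 genericW)) (PolyC.c₆ genericW) refl
  (a₁ ∷ a₂ ∷ a₃ ∷ a₄ ∷ a₆ ∷ r ∷ s ∷ t ∷ [])

*-cancelˡ : ∀ x {y z} → x ≢ 0ℚ → x ℚ.* y ≡ x ℚ.* z → y ≡ z
*-cancelˡ x {y} {z} x≢0 eq = trans (sym (shift y)) (trans (cong (1/x ℚ.*_) eq) (shift z))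
  where
  instance _ = ℚ.≢-nonZero x≢0
  1/x = ℚ.1/ x
  shift : ∀ w → 1/x ℚ.* (x ℚ.* w) ≡ w
  shift w = trans (sym (ℚₚ.*-assoc 1/x x w))
    (trans (cong (ℚ._* w) (ℚₚ.*-inverseˡ x)) (ℚₚ.*-identityˡ w))

*-zero-split : ∀ {x y} → x ≢ 0ℚ → x ℚ.* y ≡ 0ℚ → y ≡ 0ℚ
*-zero-split {x} x≢0 eq = *-cancelˡ x x≢0 (trans eq (sym (ℚₚ.*-zeroʳ x)))

*-nonzero : ∀ {x y} → x ≢ 0ℚ → y ≢ 0ℚ → x ℚ.* y ≢ 0ℚ
*-nonzero x≢0 y≢0 = y≢0 ∘ *-zero-split x≢0

-- The expansions of Δ (translate r s t W) and Δ (scale u W) are too large to normalise,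
-- which is why c₆ is needed.
Δ-translate : ∀ W r s t → ℚW.Δ (ℚW.translate r s t W) ≡ ℚW.Δ W
Δ-translate W r s t = *-cancelˡ (ι (ℤ.+ 1728)) (λ ()) (trans (1728Δ (ℚW.translate r s t W))
  (trans (cong₂ (λ c d → c ℚ.* c ℚ.* c ℚ.- d ℚ.* d) (c₄-translate W r s t) (c₆-translate W r s t))
    (sym (1728Δ W))))

pow₄ pow₁₂ : ℚ → ℚ
pow₄  u = u ℚ.* u ℚ.* (u ℚ.* u)
pow₁₂ u = pow₄ u ℚ.* pow₄ u ℚ.* pow₄ u

c₄-scale : ∀ u W → ℚW.c₄ (ℚW.scale u W) ≡ pow₄ u ℚ.* ℚW.c₄ W
c₄-scale u ⟨ a₁ , a₂ , a₃ , a₄ , a₆ ⟩ = ℚN.identity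
  (PolyW.c₄ (PolyW.scale v5 genericW))
  (v5 :* v5 :* (v5 :* v5) :* PolyW.c₄ genericW) refl
  (a₁ ∷ a₂ ∷ a₃ ∷ a₄ ∷ a₆ ∷ u ∷ [])

c₆-scale : ∀ u W → ℚC.c₆ (ℚW.scale u W) ≡ u ℚ.* u ℚ.* pow₄ u ℚ.* ℚC.c₆ W
c₆-scale u ⟨ a₁ , a₂ , a₃ , a₄ , a₆ ⟩ = ℚN.identity
  (PolyC.c₆ (PolyW.scale v5 genericW))
  (v5 :* v5 :* (v5 :* v5 :* (v5 :* v5)) :* PolyC.c₆ genericW) refl
  (a₁ ∷ a₂ ∷ a₃ ∷ a₄ ∷ a₆ ∷ u ∷ [])

Δ-scale : ∀ u W → ℚW.Δ (ℚW.scale u W) ≡ pow₁₂ u ℚ.* ℚW.Δ W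
Δ-scale u W = *-cancelˡ (ι (ℤ.+ 1728)) (λ ()) (trans (1728Δ (ℚW.scale u W))
  (trans (cong₂ (λ c d → c ℚ.* c ℚ.* c ℚ.- d ℚ.* d) (c₄-scale u W) (c₆-scale u W))
  (trans (homogeneous u (ℚW.c₄ W) (ℚC.c₆ W))
  (trans (cong (pow₁₂ u ℚ.*_) (sym (1728Δ W))) (shuffle (pow₁₂ u) (ι (ℤ.+ 1728)) (ℚW.Δ W))))))
  where
  homogeneous : ∀ u c d → let c′ = pow₄ u ℚ.* c; d′ = u ℚ.* u ℚ.* pow₄ u ℚ.* d in
    c′ ℚ.* c′ ℚ.* c′ ℚ.- d′ ℚ.* d′ ≡ pow₁₂ u ℚ.* (c ℚ.* c ℚ.* c ℚ.- d ℚ.* d)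
  homogeneous u c d = ℚN.identity {3}
    (c′ :* c′ :* c′ :- d′ :* d′) (u⁴ :* u⁴ :* u⁴ :* (v1 :* v1 :* v1 :- v2 :* v2)) refl
    (u ∷ c ∷ d ∷ [])
    where
    u⁴ = v0 :* v0 :* (v0 :* v0)
    c′ = u⁴ :* v1
    d′ = v0 :* v0 :* u⁴ :* v2
  shuffle : ∀ x y z → x ℚ.* (y ℚ.* z) ≡ y ℚ.* (x ℚ.* z)
  shuffle x y z = ℚN.identity {3} (v0 :* (v1 :* v2)) (v1 :* (v0 :* v2)) refl (x ∷ y ∷ z ∷ [])

Δ-map : ∀ V → ℚW.Δ (map ι V) ≡ ι (ℤW.Δ V)
Δ-map ⟨ a₁ , a₂ , a₃ , a₄ , a₆ ⟩ =
  sym (ι-⟦⟧ {5} (PolyW.Δ genericW) (a₁ ∷ a₂ ∷ a₃ ∷ a₄ ∷ a₆ ∷ []))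

c₄-map : ∀ V → ℚW.c₄ (map ι V) ≡ ι (ℤW.c₄ V)
c₄-map ⟨ a₁ , a₂ , a₃ , a₄ , a₆ ⟩ =
  sym (ι-⟦⟧ {5} (PolyW.c₄ genericW) (a₁ ∷ a₂ ∷ a₃ ∷ a₄ ∷ a₆ ∷ []))

-- Translation fixes c₄ and Δ, while scaling by u multiplies them by u⁴ and u¹²; both sides of the
-- isomorphism are compared.
≅-invariants : ∀ W V → W ≅ map ι V → ∃[ u ] u ≢ 0ℚ ×
  pow₄ u ℚ.* ι (ℤW.c₄ V) ≡ ℚW.c₄ W × pow₁₂ u ℚ.* ι (ℤW.Δ V) ≡ ℚW.Δ W
≅-invariants W V (u , r , s , t , u≢0 , eq) = u , u≢0 ,
  trans (cong (pow₄ u ℚ.*_) (sym (c₄-map V)))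
    (trans (sym (c₄-scale u (map ι V))) (trans (cong ℚW.c₄ eq) (c₄-translate W r s t))) ,
  trans (cong (pow₁₂ u ℚ.*_) (sym (Δ-map V)))
    (trans (sym (Δ-scale u (map ι V))) (trans (cong ℚW.Δ eq) (Δ-translate W r s t)))

-- Points of order 5

-- The curves on which (0 , 0) has order 5, with the tangent there y = 0.
module Tate (R : RawRing 0ℓ 0ℓ) where
  open RawRing R

  tate : Carrier → Carrier → Weierstrass Carrier
  tate a b = ⟨ b + - a , - (a * b) , - (a * b * b) , 0# , 0# ⟩

module ℤT = Tate ℤ.+-*-rawRing
module ℚT = Tate ℚ.+-*-rawRing
module PolyT {n : ℕ} = Tate (polyRing n)

Weierstrass-≡ : ∀ {A : Set} {a₁ a₂ a₃ a₄ a₆ b₁ b₂ b₃ b₄ b₆ : A} →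
  a₁ ≡ b₁ → a₂ ≡ b₂ → a₃ ≡ b₃ → a₄ ≡ b₄ → a₆ ≡ b₆ →
  ⟨ a₁ , a₂ , a₃ , a₄ , a₆ ⟩ ≡ ⟨ b₁ , b₂ , b₃ , b₄ , b₆ ⟩
Weierstrass-≡ refl refl refl refl refl = refl

p-p≡0 : ∀ {p q} → p ≡ q → p ℚ.- q ≡ 0ℚ
p-p≡0 {p} refl = ℚₚ.+-inverseʳ p

-- The form in which a hypothesis p ≡ q enters a polynomial computation: the remaining premise
-- exhibits l - r as a multiple of p - q and is an identity for the normaliser.
by-difference : ∀ k {l r p q} → p ≡ q → l ≡ r ℚ.+ k ℚ.* (p ℚ.- q) → l ≡ r
by-difference k {r = r} p≡q eq = trans eq (trans
  (cong (λ d → r ℚ.+ k ℚ.* d) (p-p≡0 p≡q))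
  (trans (cong (r ℚ.+_) (ℚₚ.*-zeroʳ k)) (ℚₚ.+-identityʳ r)))

÷-* : ∀ p q (q≢0 : q ≢ 0ℚ) → (p ℚ.÷ q) {{ℚ.≢-nonZero q≢0}} ℚ.* q ≡ p
÷-* p q q≢0 = trans (ℚₚ.*-assoc p (ℚ.1/ q) q)
  (trans (cong (p ℚ.*_) (ℚₚ.*-inverseˡ q)) (ℚₚ.*-identityʳ p))
  where instance _ = ℚ.≢-nonZero q≢0

module Group (E : EllipticCurve) where
  open EllipticCurve E
  open import Data.Rational.Base using (_+_; _-_; _*_; -_; _÷_)

  infixl 6 _⊞_
  _⊞_ : Point → Point → Point
  _⊞_ = _⊕_ E

  oppositeness : (x₁ y₁ y₂ : ℚ) → ℚ
  oppositeness x₁ y₁ y₂ = y₁ + y₂ + a₁ * x₁ + a₃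

  numerator : (x y : ℚ) → ℚ
  numerator x y = ι (ℤ.+ 3) * x * x + ι (ℤ.+ 2) * a₂ * x + a₄ - a₁ * y

  -- The group law as a relation. Each slope is known only through its defining equation with
  -- denominators cleared, so later computations are free of division.
  data Sum (x₁ y₁ x₂ y₂ : ℚ) : Point → Set where
    secant  : x₂ - x₁ ≢ 0ℚ → ∀ m → m * (x₂ - x₁) ≡ y₂ - y₁ →
              Sum x₁ y₁ x₂ y₂ (chord E m x₁ y₁ x₂)
    inverse : x₂ - x₁ ≡ 0ℚ → oppositeness x₁ y₁ y₂ ≡ 0ℚ → Sum x₁ y₁ x₂ y₂ O
    tangent : x₂ - x₁ ≡ 0ℚ → oppositeness x₁ y₁ y₂ ≢ 0ℚ → ∀ m →
              m * oppositeness x₁ y₁ y₂ ≡ numerator x₁ y₁ →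
              Sum x₁ y₁ x₂ y₂ (chord E m x₁ y₁ x₂)

  sum : ∀ x₁ y₁ x₂ y₂ → Sum x₁ y₁ x₂ y₂ (aff x₁ y₁ ⊞ aff x₂ y₂)
  sum x₁ y₁ x₂ y₂ with x₂ - x₁ ℚₚ.≟ 0ℚ | y₁ + y₂ + a₁ * x₁ + a₃ ℚₚ.≟ 0ℚ
  ... | no e≢0  | _       =
    let instance _ = ℚ.≢-nonZero e≢0 in
    secant e≢0 ((y₂ - y₁) ÷ (x₂ - x₁)) (÷-* (y₂ - y₁) (x₂ - x₁) e≢0)
  ... | yes e≡0 | yes d≡0 = inverse e≡0 d≡0
  ... | yes e≡0 | no d≢0  =
    let instance _ = ℚ.≢-nonZero d≢0 in
    tangent e≡0 d≢0 (numerator x₁ y₁ ÷ oppositeness x₁ y₁ y₂)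
      (÷-* (numerator x₁ y₁) (oppositeness x₁ y₁ y₂) d≢0)

  third-x : (m x₁ x₂ : ℚ) → ℚ
  third-x m x₁ x₂ = m * m + a₁ * m - a₂ - x₁ - x₂

  third-y : (m x₁ y₁ x₂ : ℚ) → ℚ
  third-y m x₁ y₁ x₂ = - (m + a₁) * third-x m x₁ x₂ - (y₁ - m * x₁) - a₃

  -- If Q ends the chord from P with abscissa equal to that of P, then P and Q
  -- are opposite; hence P ⊞ Q never uses a tangent.
  no-tangent : ∀ m x y x′ → third-x m x x′ - x ≡ 0ℚ → oppositeness x y (third-y m x y x′) ≡ 0ℚ
  no-tangent m x y x′ eq = by-difference (- (m + a₁)) eq
    (ℚN.identity {6} (v1 :+ (:- (v5 :+ v2) :* v4 :- (v1 :- v5 :* v0) :- v3) :+ v2 :* v0 :+ v3)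
      (con 0 :+ :- (v5 :+ v2) :* (v4 :- v0 :- con 0)) refl
      (x ∷ y ∷ a₁ ∷ a₃ ∷ third-x m x x′ ∷ m ∷ []))

  -- The multiples of P = (x , y) are reached by adding P again and again to the end of a chord
  -- through P; these are the two possible outcomes of one such addition.
  ChordSum : (m x y x′ : ℚ) → Set
  ChordSum m x y x′ =
    (x₂ - x ≡ 0ℚ × aff x y ⊞ chord E m x y x′ ≡ O) ⊎
    (x₂ - x ≢ 0ℚ × (∃[ n ] n * (x₂ - x) ≡ third-y m x y x′ - y ×
                    aff x y ⊞ chord E m x y x′ ≡ chord E n x y x₂))
    where x₂ = third-x m x x′

  ⊞-chord : ∀ m x y x′ → ChordSum m x y x′
  ⊞-chord m x y x′ = cases (sum x y (third-x m x x′) (third-y m x y x′)) refl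
    where
    cases : ∀ {S} → Sum x y (third-x m x x′) (third-y m x y x′) S →
            aff x y ⊞ chord E m x y x′ ≡ S → ChordSum m x y x′
    cases (secant e≢0 n eq) S≡    = inj₂ (e≢0 , n , eq , S≡)
    cases (inverse e≡0 _) S≡      = inj₁ (e≡0 , S≡)
    cases (tangent e≡0 d≢0 _ _) _ = contradiction (no-tangent m x y x′ e≡0) d≢0

  -- Only a translation is involved here; the condition on b permits the quotient a / b to be formed
  -- when the parameters are scaled to integers.
  HasTateForm : Set
  HasTateForm = ∃[ a ] ∃[ b ] b ≢ 0ℚ × (∃[ r ] ∃[ s ] ∃[ t ]
    ℚW.translate r s t equation ≡ ℚT.tate a b)

  module _ (x y s m m′ : ℚ) where
    private
      x₂ = third-x s x x
      x₃ = third-x m x x₂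
      x₄ = third-x m′ x x₃
      ρ : Vec ℚ 10
      ρ = x ∷ y ∷ s ∷ m ∷ m′ ∷ a₁ ∷ a₂ ∷ a₃ ∷ a₄ ∷ a₆ ∷ []
      M = m - s
      M′ = m′ - s
      c = m + s + a₁
      a₂′ = a₂ - s * a₁ + (x + x + x) - s * s
      a₃′ = a₃ + x * a₁ + (y + y)

    -- In the coordinates of translate x s y, the slopes of the chords are M
    -- and M′, and 2P, 3P have abscissas - a₂′ and c M.  Vanishing of the
    -- abscissa of 4P forces M′ = 0, which gives a₂′ = - M c.
    tate-form : OnCurve E (aff x y) → s * oppositeness x y y ≡ numerator x y →
                x₂ - x ≢ 0ℚ → m * (x₂ - x) ≡ third-y s x y x - y →
                x₃ - x ≢ 0ℚ → m′ * (x₃ - x) ≡ third-y m x y x₂ - y →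
                x₄ - x ≡ 0ℚ → HasTateForm
    tate-form (aff curve) slope X₂≢0 chord₂ X₃≢0 chord₃ X₄≡0 =
      M , c , c≢0 , x , s , y ,
      Weierstrass-≡
        (ℚN.identity (A₁ :+ (S :+ S)) (C :- μ) refl ρ)
        a₂′≡
        (trans a₃′≡ (trans (cong (c *_) a₂′≡)
          (ℚN.identity (C :* (:- (μ :* C))) (:- (μ :* C :* C)) refl ρ)))
        -- The coefficient a₄ vanishes because s is the slope of the tangent at P, and a₆ vanishes
        -- because P lies on the curve.
        (by-difference (- 1ℚ) slope (ℚN.identity
          (A₄ :- S :* A₃ :+ (X :* A₂ :+ X :* A₂) :- (Y :+ X :* S) :* A₁
            :+ (X :* X :+ X :* X :+ X :* X) :- (S :* Y :+ S :* Y))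
          (con 0 :+ :- con 1 :* (S :* (Y :+ Y :+ A₁ :* X :+ A₃)
            :- (con 3 :* X :* X :+ con 2 :* A₂ :* X :+ A₄ :- A₁ :* Y)))
          refl ρ))
        (by-difference (- 1ℚ) curve (ℚN.identity
          (A₆ :+ X :* A₄ :+ X :* X :* A₂ :+ X :* X :* X :- Y :* A₃ :- Y :* Y :- X :* Y :* A₁)
          (con 0 :+ :- con 1 :* (Y :* Y :+ A₁ :* X :* Y :+ A₃ :* Y
            :- (X :* X :* X :+ A₂ :* X :* X :+ A₄ :* X :+ A₆)))
          refl ρ))
      where
      X = v0
      Y = v1
      S = v2
      m₁ = v3
      m₂ = v4
      A₁ = v5
      A₂ = v6
      A₃ = v7
      A₄ = v8
      A₆ = Ι (Fin.suc (Fin.suc (Fin.suc (Fin.suc (Fin.suc (Fin.suc (Fin.suc (Fin.suc (Fin.suc Fin.zero)))))))))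
      thirdX : (m x₁ x₂ : Expr ℤ 10) → Expr ℤ 10
      thirdX m x₁ x₂ = m :* m :+ A₁ :* m :- A₂ :- x₁ :- x₂
      thirdY : (m x₁ y₁ x₂ : Expr ℤ 10) → Expr ℤ 10
      thirdY m x₁ y₁ x₂ = :- (m :+ A₁) :* thirdX m x₁ x₂ :- (y₁ :- m :* x₁) :- A₃
      X₂ = thirdX S X X
      X₃ = thirdX m₁ X X₂
      X₄ = thirdX m₂ X X₃
      μ = m₁ :- S
      μ′ = m₂ :- S
      C = m₁ :+ S :+ A₁
      A₂′ = A₂ :- S :* A₁ :+ (X :+ X :+ X) :- S :* S
      A₃′ = A₃ :+ X :* A₁ :+ (Y :+ Y)

      X₂≡ : x₂ - x ≡ - a₂′
      X₂≡ = ℚN.identity (X₂ :- X) (:- A₂′) refl ρ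

      a₃′≡ : a₃′ ≡ c * a₂′
      a₃′≡ = by-difference 1ℚ chord₂ (ℚN.identity A₃′
        (C :* A₂′ :+ con 1 :* (m₁ :* (X₂ :- X) :- (thirdY S X Y X :- Y))) refl ρ)

      X₃≡ : x₃ - x ≡ c * M
      X₃≡ = ℚN.identity (X₃ :- X) (C :* μ) refl ρ

      c≢0 : c ≢ 0ℚ
      c≢0 c≡0 = X₃≢0 (trans X₃≡ (trans (cong (_* M) c≡0) (ℚₚ.*-zeroˡ M)))

      -- The chord from P to 3P gives c (M′ + c) M = - a₃′; since a₃′ = c a₂′, the factor c cancels.
      slope₃ : (M′ + c) * M ≡ - a₂′
      slope₃ = *-cancelˡ c c≢0 (trans
        (by-difference 1ℚ chord₃ (ℚN.identity (C :* ((μ′ :+ C) :* μ))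
          (:- A₃′ :+ con 1 :* (m₂ :* (X₃ :- X) :- (thirdY m₁ X Y X₂ :- Y))) refl ρ))
        (trans (cong -_ a₃′≡) (ℚₚ.neg-distribʳ-* c a₂′)))

      M′+c≢0 : M′ + c ≢ 0ℚ
      M′+c≢0 eq = X₂≢0 (trans X₂≡ (trans (sym slope₃) (trans (cong (_* M) eq) (ℚₚ.*-zeroˡ M))))

      -- By `slope₃`, the abscissa of 4P relative to P is (M′ + c) M′.
      M′≡0 : M′ ≡ 0ℚ
      M′≡0 = *-zero-split M′+c≢0 (trans
        (by-difference 1ℚ X₄≡0 (ℚN.identity ((μ′ :+ C) :* μ′)
          ((μ′ :+ C) :* μ :- :- A₂′ :+ con 1 :* (X₄ :- X :- con 0)) refl ρ))
        (p-p≡0 slope₃))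

      a₂′≡ : a₂′ ≡ - (M * c)
      a₂′≡ = by-difference 1ℚ
        (trans (cong (λ z → (z + c) * M) (sym M′≡0)) slope₃)
        (ℚN.identity A₂′ (:- (μ :* C) :+ con 1 :* ((con 0 :+ C) :* μ :- :- A₂′)) refl ρ)

  -- If 2P, 3P or 4P were O, then 5P would be P, 2P or P, which is affine in each case. If 4P had an
  -- abscissa other than that of P, then 5P would again be affine. What is left is the hypothesis of
  -- `tate-form`.
  5-torsion⇒tate : NontrivialTorsion E 5 → HasTateForm
  5-torsion⇒tate (O , _ , _ , P≢O) = contradiction refl P≢O
  5-torsion⇒tate (P@(aff x y) , P∈E , 5P≡O , _) = double (sum x y x y) refl
    where
    5P : Point → Point
    5P 2P = P ⊞ (P ⊞ (P ⊞ 2P))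

    double : ∀ {2P} → Sum x y x y 2P → P ⊞ P ≡ 2P → HasTateForm
    double (secant e≢0 _ _) _ = contradiction (p-p≡0 {x} refl) e≢0
    double (inverse _ _) 2P≡O
      with () ← trans (sym 5P≡O) (trans (cong 5P 2P≡O) (cong (P ⊞_) 2P≡O))
    double (tangent _ _ s slope) 2P≡ with ⊞-chord s x y x
    ... | inj₁ (_ , 3P≡O)
      with () ← trans (sym 5P≡O) (trans (cong 5P 2P≡)
                  (trans (cong (λ Q → P ⊞ (P ⊞ Q)) 3P≡O) 2P≡))
    ... | inj₂ (X₂≢0 , m , chord₂ , 3P≡) with ⊞-chord m x y (third-x s x x)
    ...   | inj₁ (_ , 4P≡O)
      with () ← trans (sym 5P≡O) (trans (cong 5P 2P≡)
                  (trans (cong (λ Q → P ⊞ (P ⊞ Q)) 3P≡) (cong (P ⊞_) 4P≡O)))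
    ...   | inj₂ (X₃≢0 , m′ , chord₃ , 4P≡) with ⊞-chord m′ x y (third-x m x (third-x s x x))
    ...     | inj₁ (X₄≡0 , _) = tate-form x y s m m′ P∈E slope X₂≢0 chord₂ X₃≢0 chord₃ X₄≡0
    ...     | inj₂ (_ , _ , _ , 5P≡)
      with () ← trans (sym 5P≡O) (trans (cong 5P 2P≡)
                  (trans (cong (λ Q → P ⊞ (P ⊞ Q)) 3P≡) (trans (cong (P ⊞_) 4P≡) 5P≡)))

-- Scaling to coprime integral parameters

numerator≡ : ∀ t → t ℚ.* ι (ℚ.↧ t) ≡ ι (ℚ.↥ t)
numerator≡ t@record{} = sym (ι-via (ℚ.↥ t) (ℚᵘₚ.≃-trans (ℚₚ.toℚᵘ-homo-* t (ι (ℚ.↧ t)))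
  (ℚᵘₚ.≃-trans (ℚᵘₚ.*-congˡ (ι-toℚᵘ (ℚ.↧ t)))
    (ℚᵘ.*≡* (trans (ℤₚ.*-identityʳ (ℚ.↥ t ℤ.* ℚ.↧ t))
      (cong (ℚ.↥ t ℤ.*_) (sym (ℤₚ.*-identityʳ (ℚ.↧ t)))))))))

-- A and B are the numerator and denominator of a / b in lowest terms, and u = b / B. This serves
-- both for the parameters of the Tate form and for the scaling factors of two models.
common-factor : ∀ a b → b ≢ 0ℚ → ∃[ A ] ∃[ B ] ∃[ u ] Coprime ∣ A ∣ ∣ B ∣ × u ≢ 0ℚ ×
  u ℚ.* ι A ≡ a × u ℚ.* ι B ≡ b
common-factor a b b≢0 = ℚ.↥ t , B , u , coprime t , u≢0 , uA≡a , uB≡b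
  where
  t = (a ℚ.÷ b) {{ℚ.≢-nonZero b≢0}}
  B = ℚ.↧ t
  B≢0 : ι B ≢ 0ℚ
  B≢0 eq with () ← ι-injective {B} {ℤ.0ℤ} eq
  u = (b ℚ.÷ ι B) {{ℚ.≢-nonZero B≢0}}
  coprime : ∀ t → Coprime ∣ ℚ.↥ t ∣ ∣ ℚ.↧ t ∣
  coprime (ℚ.mkℚ n d c) = Coprimality.recompute c
  uB≡b : u ℚ.* ι B ≡ b
  uB≡b = ÷-* b (ι B) B≢0
  u≢0 : u ≢ 0ℚ
  u≢0 u≡0 = b≢0 (trans (sym uB≡b) (trans (cong (ℚ._* ι B) u≡0) (ℚₚ.*-zeroˡ (ι B))))
  uA≡a : u ℚ.* ι (ℚ.↥ t) ≡ a
  uA≡a = trans (cong (u ℚ.*_) (sym (numerator≡ t))) (trans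
    (ℚN.identity {3} (v0 :* (v1 :* v2)) (v1 :* (v0 :* v2)) refl (u ∷ t ∷ ι B ∷ []))
    (trans (cong (t ℚ.*_) uB≡b) (÷-* a b b≢0)))

-- The i-th coefficient of the Tate form is homogeneous of degree i in (a , b), which matches its
-- weight under scaling.
scale-tate : ∀ u A B → ℚW.scale u (map ι (ℤT.tate A B)) ≡ ℚT.tate (u ℚ.* ι A) (u ℚ.* ι B)
scale-tate u A B = trans (cong (ℚW.scale u) map-tate) (Weierstrass-≡
  (ℚN.identity (v0 :* (v2 :- v1)) (v0 :* v2 :- v0 :* v1) refl ρ)
  (ℚN.identity (v0 :* v0 :* :- (v1 :* v2)) (:- (v0 :* v1 :* (v0 :* v2))) refl ρ)
  (ℚN.identity (v0 :* v0 :* v0 :* :- (v1 :* v2 :* v2))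
    (:- (v0 :* v1 :* (v0 :* v2) :* (v0 :* v2))) refl ρ)
  (ℚₚ.*-zeroʳ (u ℚ.* u ℚ.* (u ℚ.* u)))
  (ℚₚ.*-zeroʳ (u ℚ.* u ℚ.* (u ℚ.* u) ℚ.* (u ℚ.* u))))
  where
  ρ : Vec ℚ 3
  ρ = u ∷ ι A ∷ ι B ∷ []
  eval : ∀ (e : Expr ℤ 2) → ι (ℤN.⟦ e ⟧ (A ∷ B ∷ [])) ≡ ℚN.⟦ e ⟧ (ι A ∷ ι B ∷ [])
  eval e = ι-⟦⟧ e (A ∷ B ∷ [])
  map-tate : map ι (ℤT.tate A B) ≡ ℚT.tate (ι A) (ι B)
  map-tate = Weierstrass-≡ (eval (v1 :- v0)) (eval (:- (v0 :* v1)))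
    (eval (:- (v0 :* v1 :* v1))) refl refl

5-torsion⇒tate-model : ∀ E → NontrivialTorsion E 5 →
  ∃[ A ] ∃[ B ] Coprime ∣ A ∣ ∣ B ∣ × IntegralModel E (ℤT.tate A B)
5-torsion⇒tate-model E torsion =
  let a , b , b≢0 , r , s , t , eq = Group.5-torsion⇒tate E torsion
      A , B , u , coprime , u≢0 , uA≡a , uB≡b = common-factor a b b≢0
  in A , B , coprime , u , r , s , t , u≢0 ,
     trans (scale-tate u A B) (trans (cong₂ ℚT.tate uA≡a uB≡b) (sym eq))

-- Minimality of the Tate model

open import Data.Nat.Base using (_*_; _^_; _≤_)

prime∣1⇒⊥ : ∀ {p} → Prime p → ¬ p ∣ 1
prime∣1⇒⊥ pr p∣1 = ¬prime[1] (subst Prime (∣1⇒≡1 p∣1) pr)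

prime-divisor : ∀ n → n ≢ 1 → ∃[ p ] Prime p × p ∣ n
prime-divisor zero _ = 2 , prime[2] , 2 ∣0
prime-divisor n@(suc _) n≢1 = cases factors isFactorisation factorsPrime
  where
  open PrimeFactorisation (factorise n)
  cases : ∀ fs → n ≡ product fs → All Prime fs → ∃[ p ] Prime p × p ∣ n
  cases []       eq _        = contradiction eq n≢1
  cases (p ∷ fs) eq (pr ∷ _) = p , pr , divides (product fs) (trans eq (ℕₚ.*-comm p (product fs)))

prime-∣-prime : ∀ {p q} → Prime p → Prime q → p ∣ q → p ≡ q
prime-∣-prime pr qr p∣q with prime⇒irreducible qr p∣q
... | inj₁ refl = contradiction pr ¬prime[1]
... | inj₂ p≡q  = p≡q

coprime-prime : ∀ {p m n} → Prime p → Coprime m n → p ∣ m → ¬ p ∣ n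
coprime-prime pr c p∣m p∣n = ¬prime[1] (subst Prime (c (p∣m , p∣n)) pr)

prime∣square : ∀ {p} n → Prime p → p ∣ n * n → p ∣ n
prime∣square n pr = [ id , id ]′ ∘ euclidsLemma n n pr

prime^∣*⇒∣ : ∀ {p} k {m n} → Prime p → ¬ p ∣ m → p ^ k ∣ m * n → p ^ k ∣ n
prime^∣*⇒∣ zero    {n = n} _ _ _ = 1∣ n
prime^∣*⇒∣ {p} (suc k) {m} {n} pr p∤m d with euclidsLemma m n pr (∣-trans (m∣m*n (p ^ k)) d)
... | inj₁ p∣m = contradiction p∣m p∤m
... | inj₂ (divides q refl) = subst (_∣ q * p) (ℕₚ.*-comm (p ^ k) p) (*-monoˡ-∣ p
        (prime^∣*⇒∣ k pr p∤m (*-cancelˡ-∣ p {{prime⇒nonZero pr}}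
          (subst (p * p ^ k ∣_) (trans (sym (ℕₚ.*-assoc m q p)) (ℕₚ.*-comm (m * q) p)) d))))

module _ {p : ℕ} (pr : Prime p) where
  prime∣*ℤ : ∀ x y → ℤ.+ p ℤS.∣ x ℤ.* y → ℤ.+ p ℤS.∣ x ⊎ ℤ.+ p ℤS.∣ y
  prime∣*ℤ x y d with euclidsLemma ∣ x ∣ ∣ y ∣ pr (subst (p ∣_) (ℤₚ.abs-* x y) (ℤS.∣⇒∣ᵤ d))
  ... | inj₁ d′ = inj₁ (ℤS.∣ᵤ⇒∣ d′)
  ... | inj₂ d′ = inj₂ (ℤS.∣ᵤ⇒∣ d′)

  prime∣²ℤ : ∀ x → ℤ.+ p ℤS.∣ x ℤ.* x → ℤ.+ p ℤS.∣ x
  prime∣²ℤ x = [ id , id ]′ ∘ prime∣*ℤ x x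

  prime∣⁵ℤ : ∀ x → ℤ.+ p ℤS.∣ x ℤ.* x ℤ.* x ℤ.* x ℤ.* x → ℤ.+ p ℤS.∣ x
  prime∣⁵ℤ x = [ [ [ prime∣²ℤ x , id ]′ ∘ prime∣*ℤ (x ℤ.* x) x , id ]′ ∘ prime∣*ℤ (x ℤ.* x ℤ.* x) x , id ]′
    ∘ prime∣*ℤ (x ℤ.* x ℤ.* x ℤ.* x) x

module TateInvariants (A B : ℤ) where
  open import Data.Integer.Base using (_+_; _-_; -_; +_)
    renaming (_*_ to infixl 7 _·_)
  private
    ρ : Vec ℤ 2
    ρ = A ∷ B ∷ []

  Q : ℤ
  Q = A · A - + 11 · A · B - B · B

  a⁵b⁵ : ℤ
  a⁵b⁵ = A · A · A · A · A · (B · B · B · B · B)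

  Δ-tate : ℤW.Δ (ℤT.tate A B) ≡ a⁵b⁵ · Q
  Δ-tate = ℤN.identity {2} (PolyW.Δ (PolyT.tate v0 v1))
    (v0 :* v0 :* v0 :* v0 :* v0 :* (v1 :* v1 :* v1 :* v1 :* v1) :*
      (v0 :* v0 :- con 11 :* v0 :* v1 :- v1 :* v1)) refl ρ

  -- Arranged so that reductions are visible: modulo AB only Q² survives, and modulo Q only 5 (AB)².
  c₄-tate : ℤW.c₄ (ℤT.tate A B) ≡ Q · Q + + 10 · (A · B) · Q + + 5 · ((A · B) · (A · B))
  c₄-tate = ℤN.identity {2} (PolyW.c₄ (PolyT.tate v0 v1))
    (q :* q :+ con 10 :* (v0 :* v1) :* q :+ con 5 :* ((v0 :* v1) :* (v0 :* v1))) refl ρ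
    where q = v0 :* v0 :- con 11 :* v0 :* v1 :- v1 :* v1

  ∣a⁵b⁵ : ∀ {p} → Prime p → + p ℤS.∣ a⁵b⁵ → + p ℤS.∣ A ⊎ + p ℤS.∣ B
  ∣a⁵b⁵ pr = [ inj₁ ∘ prime∣⁵ℤ pr A , inj₂ ∘ prime∣⁵ℤ pr B ]′ ∘
    prime∣*ℤ pr (A · A · A · A · A) (B · B · B · B · B)

  module _ (coprime : Coprime ∣ A ∣ ∣ B ∣) {p : ℕ} (pr : Prime p) where
    ∣A⇒∤B : + p ℤS.∣ A → ¬ + p ℤS.∣ B
    ∣A⇒∤B p∣A p∣B = coprime-prime pr coprime (ℤS.∣⇒∣ᵤ p∣A) (ℤS.∣⇒∣ᵤ p∣B)

    -- Modulo A the form Q is - B², so a common prime would also divide B.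
    ∣A⇒∤Q : + p ℤS.∣ A → ¬ + p ℤS.∣ Q
    ∣A⇒∤Q p∣A p∣Q = ∣A⇒∤B p∣A (prime∣²ℤ pr B (subst (+ p ℤS.∣_)
      (ℤN.identity {2} (v0 :* (v0 :- con 11 :* v1) :- (v0 :* v0 :- con 11 :* v0 :* v1 :- v1 :* v1))
        (v1 :* v1) refl ρ)
      (ℤS.∣m∣n⇒∣m-n (ℤS.∣m⇒∣m*n (A - + 11 · B) p∣A) p∣Q)))

    ∣B⇒∤Q : + p ℤS.∣ B → ¬ + p ℤS.∣ Q
    ∣B⇒∤Q p∣B p∣Q = ∣A⇒∤B (prime∣²ℤ pr A (subst (+ p ℤS.∣_)
      (ℤN.identity {2} (v1 :* (con 11 :* v0 :+ v1) :+ (v0 :* v0 :- con 11 :* v0 :* v1 :- v1 :* v1))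
        (v0 :* v0) refl ρ)
      (ℤS.∣m∣n⇒∣m+n (ℤS.∣m⇒∣m*n (+ 11 · A + B) p∣B) p∣Q))) p∣B

    -- Modulo AB, c₄ is Q²; a prime dividing c₄ and AB would divide Q together with A or B.
    ∤AB : + p ℤS.∣ ℤW.c₄ (ℤT.tate A B) → ¬ + p ℤS.∣ A · B
    ∤AB p∣c₄ p∣AB = [ (λ p∣A → ∣A⇒∤Q p∣A p∣Q) , (λ p∣B → ∣B⇒∤Q p∣B p∣Q) ]′ (prime∣*ℤ pr A B p∣AB)
      where
      p∣Q : + p ℤS.∣ Q
      p∣Q = prime∣²ℤ pr Q (ℤS.∣m+n∣n⇒∣m
        (subst (+ p ℤS.∣_) (trans c₄-tate (ℤN.identity {2}
          (v1 :* v1 :+ con 10 :* v0 :* v1 :+ con 5 :* (v0 :* v0))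
          (v1 :* v1 :+ v0 :* (con 10 :* v1 :+ con 5 :* v0)) refl (A · B ∷ Q ∷ []))) p∣c₄)
        (ℤS.∣m⇒∣m*n (+ 10 · Q + + 5 · (A · B)) p∣AB))

  -- Here 125 = 11² + 4 is the discriminant of the quadratic form Q.
  complete-square : (+ 2 · A - + 11 · B) · (+ 2 · A - + 11 · B) ≡ + 125 · (B · B) + + 4 · Q
  complete-square = ℤN.identity {2} (x :* x) (con 125 :* (v1 :* v1) :+ con 4 :*
      (v0 :* v0 :- con 11 :* v0 :* v1 :- v1 :* v1)) refl ρ
    where x = con 2 :* v0 :- con 11 :* v1

  -- Write Q = 625 z and X = 2A - 11B, so that X² = 125 B² + 2500 z. Then 5 can be taken out of X
  -- twice, X = 25 Z, and 5 Z² = B² + 20 z remains.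
  5⁴∣Q⇒5∣B : + 625 ℤS.∣ Q → + 5 ℤS.∣ B
  5⁴∣Q⇒5∣B (ℤS.divides z Q≡) = step₁ (prime∣²ℤ prime[5] X
      (ℤS.divides (+ 25 · (B · B) + + 500 · z) X²≡5·))
    where
    prime[5] : Prime 5
    prime[5] = from-yes (prime? 5)
    X = + 2 · A - + 11 · B
    X²≡ : X · X ≡ + 125 · (B · B) + + 4 · (z · + 625)
    X²≡ = trans complete-square (cong (λ q → + 125 · (B · B) + + 4 · q) Q≡)
    X²≡5· : X · X ≡ (+ 25 · (B · B) + + 500 · z) · + 5
    X²≡5· = trans X²≡ (ℤN.identity {2} (con 125 :* (v0 :* v0) :+ con 4 :* (v1 :* con 625))
      ((con 25 :* (v0 :* v0) :+ con 500 :* v1) :* con 5) refl (B ∷ z ∷ []))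
    step₂ : ∀ Y → + 5 ℤS.∣ Y → Y · Y ≡ (B · B + + 20 · z) · + 5 → + 5 ℤS.∣ B
    step₂ _ (ℤS.divides Z refl) eq = prime∣²ℤ prime[5] B (ℤS.divides (Z · Z - + 4 · z)
      (trans (ℤN.identity {2} (v0 :* v0) (v0 :* v0 :+ con 20 :* v1 :- con 20 :* v1) refl (B ∷ z ∷ []))
      (trans (cong (_- + 20 · z) (ℤₚ.*-cancelʳ-≡ (B · B + + 20 · z) (Z · Z · + 5) (+ 5)
        (trans (sym eq) (ℤN.identity {1} (v0 :* con 5 :* (v0 :* con 5)) (v0 :* v0 :* con 5 :* con 5) refl (Z ∷ [])))))
      (ℤN.identity {2} (v0 :* v0 :* con 5 :- con 20 :* v1) ((v0 :* v0 :- con 4 :* v1) :* con 5) refl (Z ∷ z ∷ [])))))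
    step₁ : + 5 ℤS.∣ X → + 5 ℤS.∣ B
    step₁ (ℤS.divides Y X≡) = step₂ Y (prime∣²ℤ prime[5] Y (ℤS.divides (B · B + + 20 · z) Y²≡)) Y²≡
      where
      Y²≡ : Y · Y ≡ (B · B + + 20 · z) · + 5
      Y²≡ = ℤₚ.*-cancelʳ-≡ (Y · Y) ((B · B + + 20 · z) · + 5) (+ 25)
        (trans (ℤN.identity {1} (v0 :* v0 :* con 25) (v0 :* con 5 :* (v0 :* con 5)) refl (Y ∷ []))
        (trans (cong₂ _·_ (sym X≡) (sym X≡)) (trans X²≡5·
        (ℤN.identity {2} ((con 25 :* (v0 :* v0) :+ con 500 :* v1) :* con 5)
          ((v0 :* v0 :+ con 20 :* v1) :* con 5 :* con 25) refl (B ∷ z ∷ [])))))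

  ∣-last : ∀ {p} q r → p ℤS.∣ q · q + + 10 · r · q + + 5 · (r · r) → p ℤS.∣ q → p ℤS.∣ + 5 · (r · r)
  ∣-last q r d p∣q = ℤS.∣m+n∣m⇒∣n {m = q · q + + 10 · r · q} {n = + 5 · (r · r)} d
    (ℤS.∣m∣n⇒∣m+n {m = q · q} {n = + 10 · r · q} (ℤS.∣m⇒∣m*n {m = q} q p∣q) (ℤS.∣n⇒∣m*n (+ 10 · r) {n = q} p∣q))

  -- At most p = 5 can divide both, and 5⁴ ∤ Δ then.
  c₄-Δ : Coprime ∣ A ∣ ∣ B ∣ → ∀ {p} → Prime p →
         + p ℤS.∣ ℤW.c₄ (ℤT.tate A B) → ¬ p ^ 4 ∣ ∣ ℤW.Δ (ℤT.tate A B) ∣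
  c₄-Δ coprime {p} pr p∣c₄ p⁴∣Δ = 5-case p≡5 pr p∤AB p⁴∣Q
    where
    p∤AB : ¬ + p ℤS.∣ A · B
    p∤AB = ∤AB coprime pr p∣c₄
    p∤a⁵b⁵ : ¬ p ∣ ∣ a⁵b⁵ ∣
    p∤a⁵b⁵ d = p∤AB ([ ℤS.∣m⇒∣m*n B , ℤS.∣n⇒∣m*n A ]′ (∣a⁵b⁵ pr (ℤS.∣ᵤ⇒∣ d)))
    p⁴∣Q : p ^ 4 ∣ ∣ Q ∣
    p⁴∣Q = prime^∣*⇒∣ 4 pr p∤a⁵b⁵ (subst (p ^ 4 ∣_) (trans (cong ∣_∣ Δ-tate) (ℤₚ.abs-* a⁵b⁵ Q)) p⁴∣Δ)
    p∣Q : + p ℤS.∣ Q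
    p∣Q = ℤS.∣ᵤ⇒∣ (∣-trans (m∣m*n (p ^ 3)) p⁴∣Q)
    p∣5AB² : + p ℤS.∣ + 5 · ((A · B) · (A · B))
    p∣5AB² = ∣-last Q (A · B) (subst (+ p ℤS.∣_) c₄-tate p∣c₄) p∣Q
    p≡5 : p ≡ 5
    p≡5 = [ (λ d → prime-∣-prime pr (from-yes (prime? 5)) (ℤS.∣⇒∣ᵤ d))
          , (λ d → contradiction (prime∣²ℤ pr (A · B) d) p∤AB)
          ]′ (prime∣*ℤ pr (+ 5) ((A · B) · (A · B)) p∣5AB²)
    5-case : ∀ {p} → p ≡ 5 → Prime p → ¬ + p ℤS.∣ A · B → ¬ p ^ 4 ∣ ∣ Q ∣
    5-case refl _ p∤AB d = p∤AB (ℤS.∣n⇒∣m*n A (5⁴∣Q⇒5∣B (ℤS.∣ᵤ⇒∣ d)))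

-- Comparison of two integral models

pow₄ℤ pow₁₂ℤ : ℤ → ℤ
pow₄ℤ  m = m ℤ.* m ℤ.* (m ℤ.* m)
pow₁₂ℤ m = pow₄ℤ m ℤ.* pow₄ℤ m ℤ.* pow₄ℤ m

ι-pow₄ : ∀ m x → ι (pow₄ℤ m ℤ.* x) ≡ pow₄ (ι m) ℚ.* ι x
ι-pow₄ m x = ι-⟦⟧ {2} (v0 :* v0 :* (v0 :* v0) :* v1) (m ∷ x ∷ [])

ι-pow₁₂ : ∀ m x → ι (pow₁₂ℤ m ℤ.* x) ≡ pow₁₂ (ι m) ℚ.* ι x
ι-pow₁₂ m x = ι-⟦⟧ {2} (m⁴ :* m⁴ :* m⁴ :* v1) (m ∷ x ∷ [])
  where m⁴ = v0 :* v0 :* (v0 :* v0)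

pow₄-* : ∀ w k → pow₄ (w ℚ.* k) ≡ pow₄ w ℚ.* pow₄ k
pow₄-* w k = ℚN.identity {2} (p⁴ (v0 :* v1)) (p⁴ v0 :* p⁴ v1) refl (w ∷ k ∷ [])
  where
  p⁴ : Expr ℤ 2 → Expr ℤ 2
  p⁴ e = e :* e :* (e :* e)

spread₄ : ∀ w k x → pow₄ w ℚ.* ι (pow₄ℤ k ℤ.* x) ≡ pow₄ (w ℚ.* ι k) ℚ.* ι x
spread₄ w k x = trans (cong (pow₄ w ℚ.*_) (ι-pow₄ k x))
  (trans (sym (ℚₚ.*-assoc (pow₄ w) (pow₄ (ι k)) (ι x))) (cong (ℚ._* ι x) (sym (pow₄-* w (ι k)))))

spread₁₂ : ∀ w k x → pow₁₂ w ℚ.* ι (pow₁₂ℤ k ℤ.* x) ≡ pow₁₂ (w ℚ.* ι k) ℚ.* ι x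
spread₁₂ w k x = trans (cong (pow₁₂ w ℚ.*_) (ι-pow₁₂ k x)) (trans
  (ℚN.identity {3} (v0 :* v0 :* v0 :* (v1 :* v1 :* v1 :* v2))
    (v0 :* v1 :* (v0 :* v1) :* (v0 :* v1) :* v2) refl (pow₄ w ∷ pow₄ (ι k) ∷ ι x ∷ []))
  (cong (λ z → z ℚ.* z ℚ.* z ℚ.* ι x) (sym (pow₄-* w (ι k)))))

pow₄-nonzero : ∀ {w} → w ≢ 0ℚ → pow₄ w ≢ 0ℚ
pow₄-nonzero w≢0 = *-nonzero (*-nonzero w≢0 w≢0) (*-nonzero w≢0 w≢0)

pow₁₂-nonzero : ∀ {w} → w ≢ 0ℚ → pow₁₂ w ≢ 0ℚ
pow₁₂-nonzero {w} w≢0 = *-nonzero {pow₄ w ℚ.* pow₄ w} {pow₄ w} (*-nonzero w⁴≢0 w⁴≢0) w⁴≢0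
  where w⁴≢0 = pow₄-nonzero {w} w≢0

cancel₄ : ∀ {w} → w ≢ 0ℚ → ∀ m n x y →
  pow₄ (w ℚ.* ι m) ℚ.* ι x ≡ pow₄ (w ℚ.* ι n) ℚ.* ι y → pow₄ℤ m ℤ.* x ≡ pow₄ℤ n ℤ.* y
cancel₄ {w} w≢0 m n x y eq = ι-injective {pow₄ℤ m ℤ.* x} {pow₄ℤ n ℤ.* y}
  (*-cancelˡ (pow₄ w) (pow₄-nonzero w≢0) (trans (spread₄ w m x) (trans eq (sym (spread₄ w n y)))))

cancel₁₂ : ∀ {w} → w ≢ 0ℚ → ∀ m n x y →
  pow₁₂ (w ℚ.* ι m) ℚ.* ι x ≡ pow₁₂ (w ℚ.* ι n) ℚ.* ι y → pow₁₂ℤ m ℤ.* x ≡ pow₁₂ℤ n ℤ.* y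
cancel₁₂ {w} w≢0 m n x y eq = ι-injective {pow₁₂ℤ m ℤ.* x} {pow₁₂ℤ n ℤ.* y}
  (*-cancelˡ (pow₁₂ w) (pow₁₂-nonzero w≢0) (trans (spread₁₂ w m x) (trans eq (sym (spread₁₂ w n y)))))

models-ratio : ∀ W V V′ → W ≅ map ι V → W ≅ map ι V′ →
  ∃[ m ] ∃[ n ] Coprime ∣ m ∣ ∣ n ∣ × n ≢ ℤ.0ℤ ×
    pow₄ℤ m ℤ.* ℤW.c₄ V ≡ pow₄ℤ n ℤ.* ℤW.c₄ V′ ×
    pow₁₂ℤ m ℤ.* ℤW.Δ V ≡ pow₁₂ℤ n ℤ.* ℤW.Δ V′
models-ratio W V V′ W≅V W≅V′ =
  let u , u≢0 , c₄≡ , Δ≡ = ≅-invariants W V W≅V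
      u′ , u′≢0 , c₄′≡ , Δ′≡ = ≅-invariants W V′ W≅V′
      m , n , w , coprime , w≢0 , wm≡u , wn≡u′ = common-factor u u′ u′≢0
  in m , n , coprime ,
     (λ n≡0 → u′≢0 (trans (sym wn≡u′) (trans (cong (λ k → w ℚ.* ι k) n≡0) (ℚₚ.*-zeroʳ w)))) ,
     cancel₄ {w} w≢0 m n (ℤW.c₄ V) (ℤW.c₄ V′)
       (trans (cong (λ z → pow₄ z ℚ.* ι (ℤW.c₄ V)) wm≡u) (trans c₄≡ (trans (sym c₄′≡)
         (cong (λ z → pow₄ z ℚ.* ι (ℤW.c₄ V′)) (sym wn≡u′))))) ,
     cancel₁₂ {w} w≢0 m n (ℤW.Δ V) (ℤW.Δ V′)
       (trans (cong (λ z → pow₁₂ z ℚ.* ι (ℤW.Δ V)) wm≡u) (trans Δ≡ (trans (sym Δ′≡)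
         (cong (λ z → pow₁₂ z ℚ.* ι (ℤW.Δ V′)) (sym wn≡u′)))))

abs-pow₄ : ∀ m → ∣ pow₄ℤ m ∣ ≡ ∣ m ∣ * ∣ m ∣ * (∣ m ∣ * ∣ m ∣)
abs-pow₄ m = trans (ℤₚ.abs-* (m ℤ.* m) (m ℤ.* m)) (cong₂ _*_ (ℤₚ.abs-* m m) (ℤₚ.abs-* m m))

abs-pow₁₂ : ∀ m → ∣ pow₁₂ℤ m ∣ ≡ ∣ pow₄ℤ m ∣ * ∣ pow₄ℤ m ∣ * ∣ pow₄ℤ m ∣
abs-pow₁₂ m = trans (ℤₚ.abs-* (pow₄ℤ m ℤ.* pow₄ℤ m) (pow₄ℤ m))
  (cong (_* ∣ pow₄ℤ m ∣) (ℤₚ.abs-* (pow₄ℤ m) (pow₄ℤ m)))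

module _ {p : ℕ} (pr : Prime p) where
  prime∣pow₄ : ∀ n → p ∣ ∣ pow₄ℤ n ∣ → p ∣ ∣ n ∣
  prime∣pow₄ n d = prime∣square ∣ n ∣ pr (prime∣square (∣ n ∣ * ∣ n ∣) pr (subst (p ∣_) (abs-pow₄ n) d))

  prime∣pow₁₂ : ∀ n → p ∣ ∣ pow₁₂ℤ n ∣ → p ∣ ∣ n ∣
  prime∣pow₁₂ n d = prime∣pow₄ n
    ([ prime∣square ∣ pow₄ℤ n ∣ pr , id ]′ (euclidsLemma (∣ pow₄ℤ n ∣ * ∣ pow₄ℤ n ∣) ∣ pow₄ℤ n ∣ pr
      (subst (p ∣_) (abs-pow₁₂ n) d)))

∣⇒^4∣pow₄ : ∀ p m → p ∣ ∣ m ∣ → p ^ 4 ∣ ∣ pow₄ℤ m ∣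
∣⇒^4∣pow₄ p m d = subst₂ _∣_ (ℕₚ.*-assoc p p (p * p) ⟨ trans ⟩
    cong (λ x → p * (p * (p * x))) (sym (ℕₚ.*-identityʳ p))) (sym (abs-pow₄ m))
  (*-pres-∣ (*-pres-∣ d d) (*-pres-∣ d d))

pow₁₂ℤ-∣-≤ : ∀ n x → n ≢ ℤ.0ℤ → ∣ x ∣ ≤ ∣ pow₁₂ℤ n ∣ * ∣ x ∣
pow₁₂ℤ-∣-≤ n x n≢0 = ℕₚ.m≤n*m ∣ x ∣ ∣ pow₁₂ℤ n ∣ {{ℕ.≢-nonZero nonzero}}
  where
  n⁴≢0 : ∣ pow₄ℤ n ∣ ≢ 0
  n⁴≢0 eq = n≢0 (ℤₚ.∣i∣≡0⇒i≡0 ([ square , square ]′ (ℕₚ.m*n≡0⇒m≡0∨n≡0 (∣ n ∣ * ∣ n ∣) (trans (sym (abs-pow₄ n)) eq))))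
    where
    square : ∣ n ∣ * ∣ n ∣ ≡ 0 → ∣ n ∣ ≡ 0
    square = [ id , id ]′ ∘ ℕₚ.m*n≡0⇒m≡0∨n≡0 ∣ n ∣
  nonzero : ∣ pow₁₂ℤ n ∣ ≢ 0
  nonzero eq = [ [ n⁴≢0 , n⁴≢0 ]′ ∘ ℕₚ.m*n≡0⇒m≡0∨n≡0 ∣ pow₄ℤ n ∣ , n⁴≢0 ]′
    (ℕₚ.m*n≡0⇒m≡0∨n≡0 (∣ pow₄ℤ n ∣ * ∣ pow₄ℤ n ∣) (trans (sym (abs-pow₁₂ n)) eq))

-- A prime p dividing m does not divide n, so m⁴ c₄(V) = n⁴ c₄(T) and m¹² Δ(V) = n¹² Δ(T) would give
-- p ∣ c₄(T) and p⁴ ∣ Δ(T), against `c₄-Δ`. Hence m is a unit and Δ(T) is at most Δ(V) in absolute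
-- value; minimality of V gives the converse.
tate-minimal : ∀ E A B → Coprime ∣ A ∣ ∣ B ∣ → IntegralModel E (ℤT.tate A B) →
  ∀ V → IsMinimalModel E V → ∣ ℤW.Δ V ∣ ≡ ∣ ℤW.Δ (ℤT.tate A B) ∣
tate-minimal E A B coprimeAB T-model V (V-model , V-minimal) =
  ratio (models-ratio (EllipticCurve.equation E) V T V-model T-model)
  where
  T = ℤT.tate A B
  ratio : (∃[ m ] ∃[ n ] Coprime ∣ m ∣ ∣ n ∣ × n ≢ ℤ.0ℤ ×
    pow₄ℤ m ℤ.* ℤW.c₄ V ≡ pow₄ℤ n ℤ.* ℤW.c₄ T ×
    pow₁₂ℤ m ℤ.* ℤW.Δ V ≡ pow₁₂ℤ n ℤ.* ℤW.Δ T) → ∣ ℤW.Δ V ∣ ≡ ∣ ℤW.Δ T ∣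
  ratio (m , n , coprime , n≢0 , c₄≡ , Δ≡) = ℕₚ.≤-antisym (V-minimal T T-model)
    (subst (∣ ℤW.Δ T ∣ ≤_) (sym ΔV≡) (pow₁₂ℤ-∣-≤ n (ℤW.Δ T) n≢0))
    where
    c₄≡ₙ : ∣ pow₄ℤ m ∣ * ∣ ℤW.c₄ V ∣ ≡ ∣ pow₄ℤ n ∣ * ∣ ℤW.c₄ T ∣
    c₄≡ₙ = trans (sym (ℤₚ.abs-* (pow₄ℤ m) (ℤW.c₄ V))) (trans (cong ∣_∣ c₄≡) (ℤₚ.abs-* (pow₄ℤ n) (ℤW.c₄ T)))
    Δ≡ₙ : ∣ pow₁₂ℤ m ∣ * ∣ ℤW.Δ V ∣ ≡ ∣ pow₁₂ℤ n ∣ * ∣ ℤW.Δ T ∣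
    Δ≡ₙ = trans (sym (ℤₚ.abs-* (pow₁₂ℤ m) (ℤW.Δ V))) (trans (cong ∣_∣ Δ≡) (ℤₚ.abs-* (pow₁₂ℤ n) (ℤW.Δ T)))

    no-prime : ∀ {p} → Prime p → ¬ p ∣ ∣ m ∣
    no-prime {p} pr p∣m = TateInvariants.c₄-Δ A B coprimeAB pr p∣c₄ p⁴∣Δ
      where
      p∤n : ¬ p ∣ ∣ n ∣
      p∤n = coprime-prime pr coprime p∣m
      p⁴∣m⁴ : p ^ 4 ∣ ∣ pow₄ℤ m ∣
      p⁴∣m⁴ = ∣⇒^4∣pow₄ p m p∣m
      p∣c₄ : ℤ.+ p ℤS.∣ ℤW.c₄ T
      p∣c₄ = ℤS.∣ᵤ⇒∣ ([ (λ d → contradiction (prime∣pow₄ pr n d) p∤n) , id ]′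
        (euclidsLemma ∣ pow₄ℤ n ∣ ∣ ℤW.c₄ T ∣ pr (subst (p ∣_) c₄≡ₙ
          (∣m⇒∣m*n ∣ ℤW.c₄ V ∣ (∣-trans (m∣m*n (p ^ 3)) p⁴∣m⁴)))))
      p⁴∣Δ : p ^ 4 ∣ ∣ ℤW.Δ T ∣
      p⁴∣Δ = prime^∣*⇒∣ 4 pr (p∤n ∘ prime∣pow₁₂ pr n) (subst (p ^ 4 ∣_) Δ≡ₙ
        (∣m⇒∣m*n ∣ ℤW.Δ V ∣ (subst (p ^ 4 ∣_) (sym (abs-pow₁₂ m)) (∣n⇒∣m*n (∣ pow₄ℤ m ∣ * ∣ pow₄ℤ m ∣) p⁴∣m⁴))))

    ∣m∣≡1 : ∣ m ∣ ≡ 1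
    ∣m∣≡1 with ∣ m ∣ ℕₚ.≟ 1
    ... | yes eq = eq
    ... | no neq = let p , pr , p∣m = prime-divisor ∣ m ∣ neq in contradiction p∣m (no-prime pr)

    ∣m¹²∣≡1 : ∣ pow₁₂ℤ m ∣ ≡ 1
    ∣m¹²∣≡1 = trans (abs-pow₁₂ m) (trans (cong (λ k → k * k * k) (abs-pow₄ m))
      (cong (λ k → let k⁴ = k * k * (k * k) in k⁴ * k⁴ * k⁴) ∣m∣≡1))

    ΔV≡ : ∣ ℤW.Δ V ∣ ≡ ∣ pow₁₂ℤ n ∣ * ∣ ℤW.Δ T ∣
    ΔV≡ = trans (sym (ℕₚ.*-identityˡ ∣ ℤW.Δ V ∣))
      (trans (cong (_* ∣ ℤW.Δ V ∣) (sym ∣m¹²∣≡1)) Δ≡ₙ)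

-- Diophantine equations in powers of primes

open import Data.Nat.Base using (_+_; _<_; z≤n; s≤s)

prime-∣-^ : ∀ {p q} k → Prime p → Prime q → p ∣ q ^ k → p ≡ q
prime-∣-^ zero pr qr d = contradiction d (prime∣1⇒⊥ pr)
prime-∣-^ {q = q} (suc k) pr qr d with euclidsLemma q (q ^ k) pr d
... | inj₁ p∣q  = prime-∣-prime pr qr p∣q
... | inj₂ p∣qᵏ = prime-∣-^ k pr qr p∣qᵏ

prime-power : ∀ {p} n → (∀ {ℓ} → Prime ℓ → ℓ ∣ n → ℓ ≡ p) → ∃[ k ] n ≡ p ^ k
-- Zero is excluded because 2 and 3 both divide it and would both equal p.
prime-power zero only with () ← trans (only prime[2] (2 ∣0)) (sym (only (from-yes (prime? 3)) (3 ∣0)))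
prime-power {p} n@(suc _) only = let k , eq = power factors factorsPrime only′ in k , trans isFactorisation eq
  where
  open PrimeFactorisation (factorise n)
  only′ : ∀ {ℓ} → Prime ℓ → ℓ ∣ product factors → ℓ ≡ p
  only′ {ℓ} pr d = only pr (subst (ℓ ∣_) (sym isFactorisation) d)
  power : ∀ fs → All Prime fs → (∀ {ℓ} → Prime ℓ → ℓ ∣ product fs → ℓ ≡ p) → ∃[ k ] product fs ≡ p ^ k
  power []       _          _    = 0 , refl
  power (f ∷ fs) (pr ∷ prs) only =
    let k , eq = power fs prs (λ pr′ d → only pr′ (∣n⇒∣m*n f d))
    in suc k , cong₂ _*_ (only pr (m∣m*n (product fs))) eq

-- The integral points needed of X² ∓ 4z² = 125 are found by search.
square-difference : ∀ x z → x * x ≡ 125 + 4 * (z * z) → (x ≡ 63 × z ≡ 31) ⊎ (x ≡ 15 × z ≡ 5)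
square-difference x z eq = from-yes (ℕₚ.allUpTo? (λ z → ℕₚ.allUpTo? (λ x →
    x * x ℕₚ.≟ 125 + 4 * (z * z) →-dec
      ((x ℕₚ.≟ 63 ×-dec z ℕₚ.≟ 31) ⊎-dec (x ℕₚ.≟ 15 ×-dec z ℕₚ.≟ 5))) 64) 32)
  z<32 x<64 eq
  where
  open ℕₚ.≤-Reasoning
  2z<x : 2 * z < x
  2z<x = ℕₚ.≰⇒> λ x≤2z → ℕₚ.<-irrefl refl (begin-strict
    x * x               ≤⟨ ℕₚ.*-mono-≤ x≤2z x≤2z ⟩
    2 * z * (2 * z)     ≡⟨ expand z ⟩
    4 * (z * z)         <⟨ ℕₚ.m<n+m (4 * (z * z)) {125} (s≤s z≤n) ⟩
    125 + 4 * (z * z)   ≡⟨ sym eq ⟩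
    x * x               ∎)
    where
    expand : ∀ z → 2 * z * (2 * z) ≡ 4 * (z * z)
    expand = solve-∀
  -- From x ≥ 2z + 1 follows 4z + 1 ≤ 125, which fails from z = 32 on.
  z<32 : z < 32
  z<32 = ℕₚ.≰⇒> λ 32≤z → ℕₚ.<-irrefl refl (begin-strict
    x * x                         ≡⟨ eq ⟩
    125 + 4 * (z * z)             <⟨ ℕₚ.+-monoˡ-< (4 * (z * z)) (ℕₚ.m≤m+n 126 3) ⟩
    1 + 4 * 32 + 4 * (z * z)      ≤⟨ ℕₚ.+-monoˡ-≤ (4 * (z * z)) (s≤s (ℕₚ.*-monoʳ-≤ 4 32≤z)) ⟩
    1 + 4 * z + 4 * (z * z)       ≡⟨ expand z ⟩
    suc (2 * z) * suc (2 * z)     ≤⟨ ℕₚ.*-mono-≤ 2z<x 2z<x ⟩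
    x * x                         ∎)
    where
    expand : ∀ z → 1 + 4 * z + 4 * (z * z) ≡ suc (2 * z) * suc (2 * z)
    expand = solve-∀
  x<64 : x < 64
  x<64 = ℕₚ.≰⇒> λ 64≤x → ℕₚ.<-irrefl refl (begin-strict
    x * x                 ≡⟨ eq ⟩
    125 + 4 * (z * z)     ≤⟨ ℕₚ.+-monoʳ-≤ 125 (ℕₚ.*-monoʳ-≤ 4 (ℕₚ.*-mono-≤ (ℕₚ.≤-pred z<32) (ℕₚ.≤-pred z<32))) ⟩
    3969                  <⟨ ℕₚ.m≤m+n 3970 126 ⟩
    64 * 64               ≤⟨ ℕₚ.*-mono-≤ 64≤x 64≤x ⟩
    x * x                 ∎)

square-sum : ∀ x z → x * x + 4 * (z * z) ≡ 125 → (x ≡ 11 × z ≡ 1) ⊎ (x ≡ 5 × z ≡ 5)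
square-sum x z eq = from-yes (ℕₚ.allUpTo? (λ z → ℕₚ.allUpTo? (λ x →
    x * x + 4 * (z * z) ℕₚ.≟ 125 →-dec
      ((x ℕₚ.≟ 11 ×-dec z ℕₚ.≟ 1) ⊎-dec (x ℕₚ.≟ 5 ×-dec z ℕₚ.≟ 5))) 12) 6)
  z<6 x<12 eq
  where
  open ℕₚ.≤-Reasoning
  z<6 : z < 6
  z<6 = ℕₚ.≰⇒> λ 6≤z → ℕₚ.<-irrefl refl (begin-strict
    125                    <⟨ ℕₚ.m≤m+n 126 18 ⟩
    4 * (6 * 6)            ≤⟨ ℕₚ.*-monoʳ-≤ 4 (ℕₚ.*-mono-≤ 6≤z 6≤z) ⟩
    4 * (z * z)            ≤⟨ ℕₚ.m≤n+m (4 * (z * z)) (x * x) ⟩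
    x * x + 4 * (z * z)    ≡⟨ eq ⟩
    125                    ∎)
  x<12 : x < 12
  x<12 = ℕₚ.≰⇒> λ 12≤x → ℕₚ.<-irrefl refl (begin-strict
    125                    <⟨ ℕₚ.m≤m+n 126 18 ⟩
    12 * 12                ≤⟨ ℕₚ.*-mono-≤ 12≤x 12≤x ⟩
    x * x                  ≤⟨ ℕₚ.m≤m+n (x * x) (4 * (z * z)) ⟩
    x * x + 4 * (z * z)    ≡⟨ eq ⟩
    125                    ∎)

factors-125 : ∀ c d → c * d ≡ 125 → (c ≡ 1 × d ≡ 125) ⊎ (c ≡ 5 × d ≡ 25) ⊎ (c ≡ 25 × d ≡ 5) ⊎ (c ≡ 125 × d ≡ 1)
factors-125 c d eq = cofactor (from-yes (ℕₚ.allUpTo? (λ c → (c ∣? 125) →-dec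
    (c ℕₚ.≟ 1 ⊎-dec c ℕₚ.≟ 5 ⊎-dec c ℕₚ.≟ 25 ⊎-dec c ℕₚ.≟ 125)) 126)
    (s≤s (∣⇒≤ c∣125)) c∣125)
  where
  c∣125 : c ∣ 125
  c∣125 = divides d (trans (sym eq) (ℕₚ.*-comm c d))
  divide : ∀ k e .{{_ : ℕ.NonZero k}} → c ≡ k → k * e ≡ 125 → c ≡ k × d ≡ e
  divide k e refl eq′ = refl , ℕₚ.*-cancelˡ-≡ d e k (trans eq (sym eq′))
  cofactor : c ≡ 1 ⊎ c ≡ 5 ⊎ c ≡ 25 ⊎ c ≡ 125 → _
  cofactor (inj₁ e)               = inj₁ (divide 1 125 e refl)
  cofactor (inj₂ (inj₁ e))        = inj₂ (inj₁ (divide 5 25 e refl))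
  cofactor (inj₂ (inj₂ (inj₁ e))) = inj₂ (inj₂ (inj₁ (divide 25 5 e refl)))
  cofactor (inj₂ (inj₂ (inj₂ e))) = inj₂ (inj₂ (inj₂ (divide 125 1 e refl)))

parity : ∀ n → (∃[ k ] n ≡ 2 * k) ⊎ (∃[ k ] n ≡ 1 + 2 * k)
parity zero = inj₁ (0 , refl)
parity (suc n) with parity n
... | inj₁ (k , refl) = inj₂ (k , refl)
... | inj₂ (k , refl) = inj₁ (suc k , sym (ℕₚ.*-suc 2 k))

odd-square : ∀ k → ∃[ m ] (1 + 2 * k) * (1 + 2 * k) ≡ 1 + 8 * m
odd-square k with parity k
... | inj₁ (j , refl) = j * (2 * j + 1) , expand j
  where
  expand : ∀ j → (1 + 2 * (2 * j)) * (1 + 2 * (2 * j)) ≡ 1 + 8 * (j * (2 * j + 1))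
  expand = solve-∀
... | inj₂ (j , refl) = (2 * j + 1) * (j + 1) , expand j
  where
  expand : ∀ j → (1 + 2 * (1 + 2 * j)) * (1 + 2 * (1 + 2 * j)) ≡ 1 + 8 * ((2 * j + 1) * (j + 1))
  expand = solve-∀

4∤1+square : ∀ y → ¬ 4 ∣ y * y + 1
4∤1+square y d with parity y
... | inj₁ (k , refl) = from-no (4 ∣? 1) (∣m+n∣m⇒∣n d (divides (k * k) (expand k)))
  where
  expand : ∀ k → 2 * k * (2 * k) ≡ k * k * 4
  expand = solve-∀
... | inj₂ (k , refl) = from-no (4 ∣? 2) (∣m+n∣m⇒∣n (subst (4 ∣_) (regroup k) d) (divides (k * k + k) refl))
  where
  regroup : ∀ k → (1 + 2 * k) * (1 + 2 * k) + 1 ≡ (k * k + k) * 4 + 2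
  regroup = solve-∀

2∤1+2* : ∀ j → ¬ 2 ∣ 1 + 2 * j
2∤1+2* j d = from-no (2 ∣? 1) (∣m+n∣n⇒∣m d (m∣m*n j))
  where
  ∣m+n∣n⇒∣m : ∀ {i m n} → i ∣ m + n → i ∣ n → i ∣ m
  ∣m+n∣n⇒∣m {i} {m} {n} d = ∣m+n∣m⇒∣n (subst (i ∣_) (ℕₚ.+-comm m n) d)

-- One of k and k + 1 is odd, so 2ⁿ divides the other.
consecutive-product : ∀ k n → k * (1 + k) ≢ 125 * 2 ^ n
consecutive-product k n eq = cases (parity k)
  where
  T = 2 ^ n
  instance _ = ℕₚ.m^n≢0 2 n
  p∤T : ∀ {p} → Prime p → p ≢ 2 → ¬ p ∣ T
  p∤T pr p≢2 d = p≢2 (prime-∣-^ n pr prime[2] d)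
  prime[3] = from-yes (prime? 3)
  prime[31] = from-yes (prime? 31)
  c*T : ∀ c m → c * T ≡ m → c ∣ m
  c*T c m refl = m∣m*n T

  k≡cT : ∀ c → k ≡ c * T → c * (1 + k) ≡ 125
  k≡cT c k≡ = ℕₚ.*-cancelʳ-≡ (c * (1 + k)) 125 T
    (trans (swap c (1 + k) T) (trans (cong (_* (1 + k)) (sym k≡)) eq))
    where
    swap : ∀ a b c → a * b * c ≡ a * c * b
    swap = solve-∀

  1+k≡cT : ∀ c → 1 + k ≡ c * T → c * k ≡ 125
  1+k≡cT c k≡ = ℕₚ.*-cancelʳ-≡ (c * k) 125 T
    (trans (swap c k T) (trans (cong (k *_) (sym k≡)) eq))
    where
    swap : ∀ a b c → a * b * c ≡ b * (a * c)
    swap = solve-∀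

  -- As c and 1 + k are complementary divisors of 125, c T = k is 124, 24, 4 or 0 for c = 1, 5, 25,
  -- 125. In the first case 31 would divide a power of 2.
  even : ∀ c → k ≡ c * T → ⊥
  even c k≡ with factors-125 c (1 + k) (k≡cT c k≡)
  ... | inj₁ (refl , 1+k≡)               = p∤T prime[31] (λ ())
          (divides 4 (trans (sym (ℕₚ.+-identityʳ T)) (trans (sym k≡) (ℕₚ.suc-injective 1+k≡))))
  ... | inj₂ (inj₁ (refl , 1+k≡))        = from-no (5 ∣? 24) (c*T 5 24 (trans (sym k≡) (ℕₚ.suc-injective 1+k≡)))
  ... | inj₂ (inj₂ (inj₁ (refl , 1+k≡))) = from-no (25 ∣? 4) (c*T 25 4 (trans (sym k≡) (ℕₚ.suc-injective 1+k≡)))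
  ... | inj₂ (inj₂ (inj₂ (refl , 1+k≡))) = ℕ.≢-nonZero⁻¹ (125 * T) {{ℕₚ.m*n≢0 125 T}}
          (trans (sym k≡) (ℕₚ.suc-injective 1+k≡))

  -- Likewise c T = 1 + k is 126, 26, 6 or 2; in the first case 3 would divide a power of 2.
  odd : ∀ c → 1 + k ≡ c * T → ⊥
  odd c 1+k≡ with factors-125 c k (1+k≡cT c 1+k≡)
  ... | inj₁ (refl , k≡)               = p∤T prime[3] (λ ())
          (divides 42 (trans (sym (ℕₚ.+-identityʳ T)) (trans (sym 1+k≡) (cong suc k≡))))
  ... | inj₂ (inj₁ (refl , k≡))        = from-no (5 ∣? 26) (c*T 5 26 (trans (sym 1+k≡) (cong suc k≡)))
  ... | inj₂ (inj₂ (inj₁ (refl , k≡))) = from-no (25 ∣? 6) (c*T 25 6 (trans (sym 1+k≡) (cong suc k≡)))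
  ... | inj₂ (inj₂ (inj₂ (refl , k≡))) = from-no (125 ∣? 2) (c*T 125 2 (trans (sym 1+k≡) (cong suc k≡)))

  cases : (∃[ j ] k ≡ 2 * j) ⊎ (∃[ j ] k ≡ 1 + 2 * j) → ⊥
  cases (inj₁ (j , refl)) with prime^∣*⇒∣ n {1 + k} {k} prime[2] (2∤1+2* j)
                                (divides 125 (trans (ℕₚ.*-comm (1 + k) k) eq))
  ... | divides c k≡ = even c k≡
  cases (inj₂ (j , refl)) with prime^∣*⇒∣ n {k} {1 + k} prime[2] (2∤1+2* j) (divides 125 eq)
  ... | divides c 1+k≡ = odd c 1+k≡

-- Y² - 125 W² = ± 1 with W = 2 · 4ᵍ: the sign - would contradict 4 ∤ Y² + 1, and for
-- the sign + one has Y = 1 + 2k with k (k + 1) = 125 · 16ᵍ.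
no-pell : ∀ y g → let w = 2 * 2 ^ (2 * g) in ¬ (y * y + 1 ≡ 125 * (w * w) ⊎ y * y ≡ 125 * (w * w) + 1)
no-pell y g (inj₁ eq) = 4∤1+square y (divides (125 * (x * x)) (trans eq (expand x)))
  where
  x = 2 ^ (2 * g)
  expand : ∀ x → 125 * (2 * x * (2 * x)) ≡ 125 * (x * x) * 4
  expand = solve-∀
no-pell y g (inj₂ eq) with parity y
... | inj₁ (k , refl) = from-no (2 ∣? 1) (∣m+n∣m⇒∣n (subst (2 ∣_) eq (divides (2 * k * k) (even-square k)))
        (divides (250 * (x * x)) (expand x)))
  where
  x = 2 ^ (2 * g)
  expand : ∀ x → 125 * (2 * x * (2 * x)) ≡ 250 * (x * x) * 2
  expand = solve-∀
  even-square : ∀ k → 2 * k * (2 * k) ≡ 2 * k * k * 2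
  even-square = solve-∀
... | inj₂ (k , refl) = consecutive-product k (2 * g + 2 * g) (trans
        (ℕₚ.*-cancelˡ-≡ (k * (1 + k)) (125 * (x * x)) 4
          (ℕₚ.suc-injective (trans (odd-square′ k) (trans eq (expand x)))))
        (cong (125 *_) (sym (ℕₚ.^-distribˡ-+-* 2 (2 * g) (2 * g)))))
  where
  x = 2 ^ (2 * g)
  odd-square′ : ∀ k → 1 + 4 * (k * (1 + k)) ≡ (1 + 2 * k) * (1 + 2 * k)
  odd-square′ = solve-∀
  expand : ∀ x → 125 * (2 * x * (2 * x)) + 1 ≡ 1 + 4 * (125 * (x * x))
  expand = solve-∀

-- Square and unit values of the form Q

sq : ∀ x → x ℤ.* x ≡ ℤ.+ (∣ x ∣ * ∣ x ∣)
sq (ℤ.+ n)    = sym (ℤₚ.pos-* n n)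
sq ℤ.-[1+ n ] = refl

abs-cases : ∀ i {n} → ∣ i ∣ ≡ n → i ≡ ℤ.+ n ⊎ i ≡ ℤ.- ℤ.+ n
abs-cases (ℤ.+ n)    refl = inj₁ refl
abs-cases ℤ.-[1+ n ] refl = inj₂ refl

-- The values (∣ A ∣ , z) with B = ± 1 and ∣ Q A B ∣ = z².
SquareValue : ℕ → ℕ → Set
SquareValue a z =
    (a ≡ 37 × z ≡ 31) ⊎ (a ≡ 26 × z ≡ 31)
  ⊎ (a ≡ 13 × z ≡ 5) ⊎ (a ≡ 2 × z ≡ 5) ⊎ (a ≡ 8 × z ≡ 5) ⊎ (a ≡ 3 × z ≡ 5)
  ⊎ (a ≡ 11 × z ≡ 1) ⊎ (a ≡ 0 × z ≡ 1)

module _ where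
  open import Data.Integer.Base using (_-_; -_; +_; _⊖_) renaming (_+_ to infixl 6 _∔_; _*_ to infixl 7 _·_)
  open TateInvariants using (Q)

  private
    q : Expr ℤ 2
    q = v0 :* v0 :- con 11 :* v0 :* v1 :- v1 :* v1

  Q-swap : ∀ A B → ∣ Q (- B) A ∣ ≡ ∣ Q A B ∣
  Q-swap A B = trans (cong ∣_∣ (ℤN.identity {2}
    (:- v1 :* :- v1 :- con 11 :* :- v1 :* v0 :- v0 :* v0) (:- q) refl (A ∷ B ∷ []))) (ℤₚ.∣-i∣≡∣i∣ (Q A B))

  ∣X+11B∣ : ∀ X B n → ∣ X ∣ ≡ n → ∣ B ∣ ≡ 1 → ∣ X ∔ + 11 · B ∣ ≡ n + 11 ⊎ ∣ X ∔ + 11 · B ∣ ≡ ∣ n ⊖ 11 ∣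
  ∣X+11B∣ X B n ∣X∣≡ ∣B∣≡1 with abs-cases X ∣X∣≡ | abs-cases B ∣B∣≡1
  ... | inj₁ refl | inj₁ refl = inj₁ refl
  ... | inj₁ refl | inj₂ refl = inj₂ refl
  ... | inj₂ refl | inj₁ refl = inj₂ (trans (cong ∣_∣ (trans (ℤₚ.+-comm (- + n) (+ 11))
          (ℤₚ.m-n≡m⊖n 11 n))) (ℤₚ.∣m⊖n∣≡∣n⊖m∣ 11 n))
  ... | inj₂ refl | inj₂ refl = inj₁ (trans (cong ∣_∣ (sym (ℤₚ.neg-distrib-+ (+ n) (+ 11)))) (ℤₚ.∣-i∣≡∣i∣ (+ n ∔ + 11)))

  -- Since 2A = (2A - 11B) + 11B with B = ± 1, the two alternatives are equal and opposite signs of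
  -- the summands. The difference n - 11 may be negative, as for n = 5.
  half : ∀ A B n → ∣ + 2 · A - + 11 · B ∣ ≡ n → ∣ B ∣ ≡ 1 → 2 * ∣ A ∣ ≡ n + 11 ⊎ 2 * ∣ A ∣ ≡ ∣ n ⊖ 11 ∣
  half A B n ∣X∣≡ ∣B∣≡1 = subst (λ k → k ≡ n + 11 ⊎ k ≡ ∣ n ⊖ 11 ∣)
    (trans (cong ∣_∣ (ℤN.identity {2} (con 2 :* v0 :- con 11 :* v1 :+ con 11 :* v1) (con 2 :* v0) refl (A ∷ B ∷ [])))
      (ℤₚ.abs-* (+ 2) A))
    (∣X+11B∣ (+ 2 · A - + 11 · B) B n ∣X∣≡ ∣B∣≡1)

  -- With B² = 1 and X = 2A - 11B one has X² = 125 + 4Q, and the sign of Q decides between the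
  -- equations for X² - 4z² and X² + 4z². The solutions |X| = 63, 15, 11, 5 give |2A| by adding 11
  -- to |X| or taking their distance.
  square-values : ∀ A B z → ∣ B ∣ ≡ 1 → ∣ Q A B ∣ ≡ z * z → SquareValue ∣ A ∣ z
  square-values A B z ∣B∣≡1 ∣Q∣≡ = [ positive , negative ]′ (abs-cases (Q A B) ∣Q∣≡)
    where
    X = + 2 · A - + 11 · B
    halve : ∀ {n} m → 2 * n ≡ 2 * m → n ≡ m
    halve {n} m = ℕₚ.*-cancelˡ-≡ n m 2
    X²≡ : + (∣ X ∣ * ∣ X ∣) ≡ + 125 ∔ + 4 · Q A B
    X²≡ = trans (sym (sq X)) (trans (TateInvariants.complete-square A B)
      (cong (λ b → + 125 · b ∔ + 4 · Q A B) (trans (sq B) (cong (λ k → + (k * k)) ∣B∣≡1))))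
    positive : Q A B ≡ + (z * z) → SquareValue ∣ A ∣ z
    positive Q≡ = [ (λ (x≡ , z≡) → [ (λ e → inj₁ (halve 37 e , z≡)) , (λ e → inj₂ (inj₁ (halve 26 e , z≡))) ]′
                        (half A B 63 x≡ ∣B∣≡1))
                  , (λ (x≡ , z≡) → [ (λ e → inj₂ (inj₂ (inj₁ (halve 13 e , z≡))))
                                   , (λ e → inj₂ (inj₂ (inj₂ (inj₁ (halve 2 e , z≡))))) ]′
                        (half A B 15 x≡ ∣B∣≡1)) ]′
      (square-difference ∣ X ∣ z (ℤₚ.+-injective (trans X²≡ (cong (+ 125 ∔_)
        (trans (cong (+ 4 ·_) Q≡) (sym (ℤₚ.pos-* 4 (z * z))))))))
    negative : Q A B ≡ - + (z * z) → SquareValue ∣ A ∣ z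
    negative Q≡ = [ (λ (x≡ , z≡) → [ (λ e → inj₂ (inj₂ (inj₂ (inj₂ (inj₂ (inj₂ (inj₁ (halve 11 e , z≡))))))))
                                   , (λ e → inj₂ (inj₂ (inj₂ (inj₂ (inj₂ (inj₂ (inj₂ (halve 0 e , z≡)))))))) ]′
                        (half A B 11 x≡ ∣B∣≡1))
                  , (λ (x≡ , z≡) → [ (λ e → inj₂ (inj₂ (inj₂ (inj₂ (inj₁ (halve 8 e , z≡))))))
                                   , (λ e → inj₂ (inj₂ (inj₂ (inj₂ (inj₂ (inj₁ (halve 3 e , z≡))))))) ]′
                        (half A B 5 x≡ ∣B∣≡1)) ]′
      (square-sum ∣ X ∣ z (ℤₚ.+-injective (trans (cong₂ _∔_ X²≡ (ℤₚ.pos-* 4 (z * z)))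
        (trans (cong (λ w → + 125 ∔ + 4 · w ∔ + 4 · + (z * z)) Q≡)
        (ℤN.identity {1} (con 125 :+ con 4 :* :- v0 :+ con 4 :* v0) (con 125) refl (+ (z * z) ∷ []))))))

  -- With A = 2W and Y = B + 11W, Q A B = 125 W² - Y².
  power-of-4 : ∀ A B g → ∣ A ∣ ≡ 2 ^ (2 * suc g) → ∣ Q A B ∣ ≢ 1
  power-of-4 A B g ∣A∣≡ = [ (λ A≡ → go (+ w) refl (trans A≡ +2w)) , (λ A≡ → go (- + w) (ℤₚ.∣-i∣≡∣i∣ (+ w))
      (trans A≡ (trans (cong -_ +2w) (ℤₚ.neg-distribʳ-* (+ 2) (+ w))))) ]′ (abs-cases A ∣A∣≡2w)
    where
    w = 2 * 2 ^ (2 * g)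
    ∣A∣≡2w : ∣ A ∣ ≡ 2 * w
    ∣A∣≡2w = trans ∣A∣≡ (cong (2 ^_) (ℕₚ.*-suc 2 g))
    +2w : + (2 * w) ≡ + 2 · + w
    +2w = ℤₚ.pos-* 2 w
    go : ∀ W → ∣ W ∣ ≡ w → A ≡ + 2 · W → ∣ Q A B ∣ ≢ 1
    go W ∣W∣≡ A≡ ∣Q∣≡1 = no-pell ∣ Y ∣ g ([ (λ Q≡ → inj₁ (sym (ℤₚ.+-injective
          (trans (sym 125W²) (trans 125W²≡ (cong₂ _∔_ (sq Y) Q≡))))))
        , (λ Q≡ → inj₂ (ℤₚ.+-injective (trans (sym (sq Y)) (trans Y²≡ (cong₂ _-_ 125W² Q≡))))) ]′
        (abs-cases (Q A B) ∣Q∣≡1))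
      where
      Y = B ∔ + 11 · W
      125W² : + 125 · (W · W) ≡ + (125 * (w * w))
      125W² = trans (cong (+ 125 ·_) (trans (sq W) (cong (λ k → + (k * k)) ∣W∣≡))) (sym (ℤₚ.pos-* 125 (w * w)))
      y = v1 :+ con 11 :* v0
      q′ : Expr ℤ 2
      q′ = con 2 :* v0 :* (con 2 :* v0) :- con 11 :* (con 2 :* v0) :* v1 :- v1 :* v1
      125W²≡ : + 125 · (W · W) ≡ Y · Y ∔ Q A B
      125W²≡ = trans (ℤN.identity {2} (con 125 :* (v0 :* v0)) (y :* y :+ q′) refl (W ∷ B ∷ []))
        (cong (λ a → Y · Y ∔ Q a B) (sym A≡))
      Y²≡ : Y · Y ≡ + 125 · (W · W) - Q A B
      Y²≡ = trans (ℤN.identity {2} (y :* y) (con 125 :* (v0 :* v0) :- q′) refl (W ∷ B ∷ []))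
        (cong (λ a → + 125 · (W · W) - Q a B) (sym A≡))

  -- Modulo 8 such A and B are ± 1, so Q A B is ± 11.
  1-mod-8 : ∀ A B m n → ∣ A ∣ ≡ 1 + 8 * m → ∣ B ∣ ≡ 1 + 8 * n → ∣ Q A B ∣ ≢ 1
  1-mod-8 A B m n ∣A∣≡ ∣B∣≡ ∣Q∣≡1 = [ (λ d → refute (+ 11) d (from-no (8 ∣? 12)) (from-no (8 ∣? 10)))
                                   , (λ d → refute (- + 11) d (from-no (8 ∣? 10)) (from-no (8 ∣? 12))) ]′
    (mod-8 (abs-cases A ∣A∣≡) (abs-cases B ∣B∣≡))
    where
    refute : ∀ k → + 8 ℤS.∣ Q A B ∔ k → ¬ 8 ∣ ∣ + 1 ∔ k ∣ → ¬ 8 ∣ ∣ - + 1 ∔ k ∣ → ⊥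
    refute k d ¬+ ¬- = [ (λ Q≡ → ¬+ (ℤS.∣⇒∣ᵤ (subst (λ x → + 8 ℤS.∣ x ∔ k) Q≡ d)))
                       , (λ Q≡ → ¬- (ℤS.∣⇒∣ᵤ (subst (λ x → + 8 ℤS.∣ x ∔ k) Q≡ d))) ]′
                       (abs-cases (Q A B) ∣Q∣≡1)
    M = + m
    N = + n
    lift : ∀ k → + (1 + 8 * k) ≡ + 1 ∔ + 8 · + k
    lift k = cong (+ 1 ∔_) (ℤₚ.pos-* 8 k)
    -- `same` and `opposite` are the cofactors of 8 in Q + 11 for equal signs of A and B and in Q -
    -- 11 for opposite signs.
    s t same opposite : Expr ℤ 2
    s = con 1 :+ con 8 :* v0
    t = con 1 :+ con 8 :* v1
    same = :- con 9 :* v0 :+ con 8 :* v0 :* v0 :- con 13 :* v1 :- con 88 :* v0 :* v1 :- con 8 :* v1 :* v1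
    opposite = con 13 :* v0 :+ con 8 :* v0 :* v0 :+ con 9 :* v1 :+ con 88 :* v0 :* v1 :- con 8 :* v1 :* v1
    quad : (a b : Expr ℤ 2) → Expr ℤ 2
    quad a b = a :* a :- con 11 :* a :* b :- b :* b
    to : ∀ {a b} k → A ≡ a → B ≡ b → + 8 ℤS.∣ Q a b ∔ k → + 8 ℤS.∣ Q A B ∔ k
    to k refl refl d = d
    ρ : Vec ℤ 2
    ρ = M ∷ N ∷ []
    mod-8 : A ≡ + (1 + 8 * m) ⊎ A ≡ - + (1 + 8 * m) → B ≡ + (1 + 8 * n) ⊎ B ≡ - + (1 + 8 * n) →
            + 8 ℤS.∣ Q A B ∔ + 11 ⊎ + 8 ℤS.∣ Q A B ∔ - + 11
    mod-8 (inj₁ A≡) (inj₁ B≡) = inj₁ (to (+ 11) (trans A≡ (lift m)) (trans B≡ (lift n))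
      (ℤS.divides (ℤN.⟦ same ⟧ ρ) (ℤN.identity {2} (quad s t :+ con 11) (same :* con 8) refl ρ)))
    mod-8 (inj₂ A≡) (inj₂ B≡) = inj₁ (to (+ 11) (trans A≡ (cong -_ (lift m))) (trans B≡ (cong -_ (lift n)))
      (ℤS.divides (ℤN.⟦ same ⟧ ρ) (ℤN.identity {2} (quad (:- s) (:- t) :+ con 11) (same :* con 8) refl ρ)))
    mod-8 (inj₁ A≡) (inj₂ B≡) = inj₂ (to (- + 11) (trans A≡ (lift m)) (trans B≡ (cong -_ (lift n)))
      (ℤS.divides (ℤN.⟦ opposite ⟧ ρ) (ℤN.identity {2} (quad s (:- t) :- con 11) (opposite :* con 8) refl ρ)))
    mod-8 (inj₂ A≡) (inj₁ B≡) = inj₂ (to (- + 11) (trans A≡ (cong -_ (lift m))) (trans B≡ (lift n))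
      (ℤS.divides (ℤN.⟦ opposite ⟧ ρ) (ℤN.identity {2} (quad (:- s) t :- con 11) (opposite :* con 8) refl ρ)))

  -- For the case that both bad primes divide Q: then A and B are units, while 11 has only one prime
  -- divisor.
  ∣Q∣-units : ∀ A B → ∣ A ∣ ≡ 1 → ∣ B ∣ ≡ 1 → ∣ Q A B ∣ ≡ 11
  ∣Q∣-units A B ∣A∣≡1 ∣B∣≡1 with abs-cases A ∣A∣≡1 | abs-cases B ∣B∣≡1
  ... | inj₁ refl | inj₁ refl = refl
  ... | inj₁ refl | inj₂ refl = refl
  ... | inj₂ refl | inj₁ refl = refl
  ... | inj₂ refl | inj₂ refl = refl

-- The two bad primes

^-double : ∀ p h → p ^ (2 * h) ≡ p ^ h * p ^ h
^-double p h = trans (cong (λ k → p ^ (h + k)) (ℕₚ.+-identityʳ h)) (ℕₚ.^-distribˡ-+-* p h h)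

^-^5 : ∀ p i → (p ^ i) ^ 5 ≡ p ^ (5 * i)
^-^5 p i = trans (ℕₚ.^-*-assoc p i 5) (cong (p ^_) (ℕₚ.*-comm i 5))

generic-shape : ∀ {p q D} k l → D ≡ p ^ (5 * k) * q ^ (2 * l + 1) → DiscriminantShape p q D
generic-shape k l eq = inj₂ (inj₂ (inj₂ (inj₂ (inj₂ (inj₂ (k , l , eq))))))

module Classification {p q : ℕ} (pr : Prime p) (qr : Prime q) (p≢q : p ≢ q) where
  open TateInvariants using (Q)

  power-of-both : ∀ {n} → p ∣ n → q ∣ n → ∀ {ℓ k} → Prime ℓ → n ≢ ℓ ^ k
  power-of-both p∣n q∣n {ℓ} {k} ℓr refl =
    p≢q (trans (prime-∣-^ k pr ℓr p∣n) (sym (prime-∣-^ k qr ℓr q∣n)))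

  not-both-11 : ∀ {n} → p ∣ n → q ∣ n → n ≢ 11
  not-both-11 p∣n q∣n n≡11 = power-of-both p∣n q∣n {11} {1} (from-yes (prime? 11)) n≡11

  odd-exponent : ∀ {a b c i j} → a ≡ p ^ i → b ≡ 1 → c ≡ q ^ (1 + 2 * j) → DiscriminantShape p q (a ^ 5 * b ^ 5 * c)
  odd-exponent {i = i} {j} refl refl refl = generic-shape i j (cong₂ _*_
    (trans (ℕₚ.*-identityʳ ((p ^ i) ^ 5)) (^-^5 p i)) (cong (q ^_) (ℕₚ.+-comm 1 (2 * j))))

  -- If j is odd, the general shape holds with k = i. If j is even, |Q| is a square: among the
  -- values from `square-values`, 26 is not a prime power and z = 1 contradicts q ∣ Q. The others
  -- are listed discriminants, where 8⁵ appears as 2¹⁵.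
  unit-B : ∀ A B {i j} → ∣ B ∣ ≡ 1 → ∣ A ∣ ≡ p ^ i → ∣ Q A B ∣ ≡ q ^ j → q ∣ ∣ Q A B ∣ →
           DiscriminantShape p q (∣ A ∣ ^ 5 * ∣ B ∣ ^ 5 * ∣ Q A B ∣)
  unit-B A B {i} {j} ∣B∣≡1 ∣A∣≡ ∣Q∣≡ q∣Q with parity j
  ... | inj₂ (l , refl) = odd-exponent {i = i} {l} ∣A∣≡ ∣B∣≡1 ∣Q∣≡
  ... | inj₁ (h , refl) = sporadic (square-values A B z ∣B∣≡1 ∣Q∣≡z²)
    where
    z = q ^ h
    ∣Q∣≡z² : ∣ Q A B ∣ ≡ z * z
    ∣Q∣≡z² = trans ∣Q∣≡ (^-double q h)
    value : ∀ {a w} → ∣ A ∣ ≡ a → z ≡ w → ∣ A ∣ ^ 5 * ∣ B ∣ ^ 5 * ∣ Q A B ∣ ≡ a ^ 5 * 1 * (w * w)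
    value a≡ z≡ = cong₂ _*_ (cong₂ (λ a b → a ^ 5 * b ^ 5) a≡ ∣B∣≡1) (trans ∣Q∣≡z² (cong₂ _*_ z≡ z≡))
    z≢1 : z ≢ 1
    z≢1 z≡1 = prime∣1⇒⊥ qr (subst (q ∣_) (trans ∣Q∣≡z² (cong₂ _*_ z≡1 z≡1)) q∣Q)
    ∣A∣≢26 : ∣ A ∣ ≢ 26
    ∣A∣≢26 eq with () ← trans (prime-∣-^ i prime[2] pr (divides 13 (trans (sym ∣A∣≡) eq)))
      (sym (prime-∣-^ i (from-yes (prime? 13)) pr (divides 2 (trans (sym ∣A∣≡) eq))))
    sporadic : SquareValue ∣ A ∣ z → DiscriminantShape p q (∣ A ∣ ^ 5 * ∣ B ∣ ^ 5 * ∣ Q A B ∣)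
    sporadic (inj₁ (a≡ , z≡))                                            = inj₂ (inj₂ (inj₂ (inj₂ (inj₁ (value a≡ z≡)))))
    sporadic (inj₂ (inj₁ (a≡ , _)))                                      = contradiction a≡ ∣A∣≢26
    sporadic (inj₂ (inj₂ (inj₁ (a≡ , z≡))))                              = inj₂ (inj₂ (inj₂ (inj₁ (value a≡ z≡))))
    sporadic (inj₂ (inj₂ (inj₂ (inj₁ (a≡ , z≡)))))                       = inj₁ (value a≡ z≡)
    sporadic (inj₂ (inj₂ (inj₂ (inj₂ (inj₁ (a≡ , z≡))))))                = inj₂ (inj₁ (value a≡ z≡))
    sporadic (inj₂ (inj₂ (inj₂ (inj₂ (inj₂ (inj₁ (a≡ , z≡)))))))         = inj₂ (inj₂ (inj₁ (value a≡ z≡)))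
    sporadic (inj₂ (inj₂ (inj₂ (inj₂ (inj₂ (inj₂ (inj₁ (_ , z≡1))))))))  = contradiction z≡1 z≢1
    sporadic (inj₂ (inj₂ (inj₂ (inj₂ (inj₂ (inj₂ (inj₂ (_ , z≡1))))))))  = contradiction z≡1 z≢1

  -- Taking z = 1 in `square-values` leaves |A| = 11 or A = 0, and 11 is not divisible by two
  -- distinct primes.
  units-BQ : ∀ A B → A ≢ ℤ.0ℤ → ∣ B ∣ ≡ 1 → ∣ Q A B ∣ ≡ 1 → p ∣ ∣ A ∣ → ¬ q ∣ ∣ A ∣
  units-BQ A B A≢0 ∣B∣≡1 ∣Q∣≡1 p∣A q∣A = impossible (square-values A B 1 ∣B∣≡1 ∣Q∣≡1)
    where
    impossible : ¬ SquareValue ∣ A ∣ 1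
    impossible (inj₂ (inj₂ (inj₂ (inj₂ (inj₂ (inj₂ (inj₁ (a≡11 , _)))))))) = not-both-11 p∣A q∣A a≡11
    impossible (inj₂ (inj₂ (inj₂ (inj₂ (inj₂ (inj₂ (inj₂ (a≡0 , _))))))))  = A≢0 (ℤₚ.∣i∣≡0⇒i≡0 a≡0)

  -- Here |Δ| is the product of the fifth powers of |A| and |B|. An odd exponent i or j stays odd
  -- when multiplied by 5, and which of them is odd decides the order of p and q. Both even is
  -- impossible.
  two-powers : ∀ A B i j → ∣ A ∣ ≡ p ^ i → ∣ B ∣ ≡ q ^ j → p ∣ ∣ A ∣ → q ∣ ∣ B ∣ → ∣ Q A B ∣ ≡ 1 →
    let D = ∣ A ∣ ^ 5 * ∣ B ∣ ^ 5 * ∣ Q A B ∣ in DiscriminantShape p q D ⊎ DiscriminantShape q p D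
  two-powers A B i j ∣A∣≡ ∣B∣≡ p∣A q∣B ∣Q∣≡1 = cases (parity i) (parity j)
    where
    D = ∣ A ∣ ^ 5 * ∣ B ∣ ^ 5 * ∣ Q A B ∣
    D≡ : D ≡ p ^ (5 * i) * q ^ (5 * j)
    D≡ = trans (cong₂ _*_ (cong₂ (λ a b → a ^ 5 * b ^ 5) ∣A∣≡ ∣B∣≡) ∣Q∣≡1)
      (trans (ℕₚ.*-identityʳ ((p ^ i) ^ 5 * (q ^ j) ^ 5)) (cong₂ _*_ (^-^5 p i) (^-^5 q j)))
    5*odd : ∀ k → 5 * (1 + 2 * k) ≡ 2 * (2 + 5 * k) + 1
    5*odd = solve-∀

    -- A positive exponent makes half of the power of 4 an even integer, as `power-of-4` requires.
    positive : ∀ {r h n} → Prime r → r ∣ n → n ≡ r ^ (2 * h) → ∃[ g ] h ≡ suc g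
    positive {h = zero}  rr r∣n refl = contradiction r∣n (prime∣1⇒⊥ rr)
    positive {h = suc g} rr r∣n eq   = g , refl

    even-power : ∀ {r h n} → Prime r → r ∣ n → n ≡ r ^ (2 * h) → 2 ∣ r ^ h → ∃[ g ] n ≡ 2 ^ (2 * suc g)
    even-power {h = h} rr r∣n eq 2∣ with positive {h = h} rr r∣n eq | prime-∣-^ h prime[2] rr 2∣
    ... | g , refl | refl = g , eq

    -- An even p ^ h or q ^ k forces that prime to be 2; otherwise |A| and |B| are odd squares,
    -- hence 1 modulo 8.
    squares : ∀ h k → i ≡ 2 * h → j ≡ 2 * k → (∃[ e ] p ^ h ≡ 2 * e) ⊎ (∃[ e ] p ^ h ≡ 1 + 2 * e) →
              (∃[ e ] q ^ k ≡ 2 * e) ⊎ (∃[ e ] q ^ k ≡ 1 + 2 * e) → ⊥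
    squares h k refl refl (inj₁ (e , even)) _ =
      let g , ∣A∣≡4^ = even-power {h = h} pr p∣A ∣A∣≡ (divides e (trans even (ℕₚ.*-comm 2 e)))
      in power-of-4 A B g ∣A∣≡4^ ∣Q∣≡1
    squares h k refl refl _ (inj₁ (e , even)) =
      let g , ∣B∣≡4^ = even-power {h = k} qr q∣B ∣B∣≡ (divides e (trans even (ℕₚ.*-comm 2 e)))
      in power-of-4 (ℤ.- B) A g (trans (ℤₚ.∣-i∣≡∣i∣ B) ∣B∣≡4^) (trans (Q-swap A B) ∣Q∣≡1)
    squares h k refl refl (inj₂ (e , odd₁)) (inj₂ (f , odd₂)) =
      let m , x² = odd-square e
          n , y² = odd-square f
      in 1-mod-8 A B m n
           (trans ∣A∣≡ (trans (^-double p h) (trans (cong₂ _*_ odd₁ odd₁) x²)))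
           (trans ∣B∣≡ (trans (^-double q k) (trans (cong₂ _*_ odd₂ odd₂) y²))) ∣Q∣≡1

    cases : (∃[ h ] i ≡ 2 * h) ⊎ (∃[ h ] i ≡ 1 + 2 * h) → (∃[ k ] j ≡ 2 * k) ⊎ (∃[ k ] j ≡ 1 + 2 * k) →
            DiscriminantShape p q D ⊎ DiscriminantShape q p D
    cases _ (inj₂ (k , j≡)) = inj₁ (generic-shape i (2 + 5 * k)
      (trans D≡ (cong (λ e → p ^ (5 * i) * q ^ e) (trans (cong (5 *_) j≡) (5*odd k)))))
    cases (inj₂ (h , i≡)) _ = inj₂ (generic-shape j (2 + 5 * h)
      (trans D≡ (trans (ℕₚ.*-comm (p ^ (5 * i)) (q ^ (5 * j)))
        (cong (λ e → q ^ (5 * j) * p ^ e) (trans (cong (5 *_) i≡) (5*odd h))))))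
    cases (inj₁ (h , i≡)) (inj₁ (k , j≡)) =
      contradiction (squares h k i≡ j≡ (parity (p ^ h)) (parity (q ^ k))) λ ()

  OnlyPrimes : ℕ → Set
  OnlyPrimes n = ∀ {ℓ} → Prime ℓ → ℓ ∣ n → ℓ ≡ p ⊎ ℓ ≡ q

  q-power : ∀ {n} → OnlyPrimes n → ¬ p ∣ n → ∃[ k ] n ≡ q ^ k
  q-power {n} only p∤n = prime-power n λ ℓr d →
    [ (λ ℓ≡p → contradiction (subst (_∣ n) ℓ≡p d) p∤n) , id ]′ (only ℓr d)

  p-power : ∀ {n} → OnlyPrimes n → ¬ q ∣ n → ∃[ k ] n ≡ p ^ k
  p-power {n} only q∤n = prime-power n λ ℓr d →
    [ id , (λ ℓ≡q → contradiction (subst (_∣ n) ℓ≡q d) q∤n) ]′ (only ℓr d)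

  unit : ∀ {n} → OnlyPrimes n → ¬ p ∣ n → ¬ q ∣ n → n ≡ 1
  unit {n} only p∤n q∤n with n ℕₚ.≟ 1
  ... | yes n≡1 = n≡1
  ... | no n≢1  = let ℓ , ℓr , ℓ∣n = prime-divisor n n≢1 in
    [ (λ ℓ≡p → contradiction (subst (_∣ n) ℓ≡p ℓ∣n) p∤n)
    , (λ ℓ≡q → contradiction (subst (_∣ n) ℓ≡q ℓ∣n) q∤n) ]′ (only ℓr ℓ∣n)

abs-^5 : ∀ x → ∣ x ℤ.* x ℤ.* x ℤ.* x ℤ.* x ∣ ≡ ∣ x ∣ ^ 5
abs-^5 x = trans (ℤₚ.abs-* (x ℤ.* x ℤ.* x ℤ.* x) x) (trans (cong (_* ∣ x ∣)
  (trans (ℤₚ.abs-* (x ℤ.* x ℤ.* x) x) (cong (_* ∣ x ∣)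
  (trans (ℤₚ.abs-* (x ℤ.* x) x) (cong (_* ∣ x ∣) (ℤₚ.abs-* x x)))))) (fifth ∣ x ∣))
  where
  fifth : ∀ n → n * n * n * n * n ≡ n * (n * (n * (n * (n * 1))))
  fifth = solve-∀

∣Δ-tate∣ : ∀ A B → ∣ ℤW.Δ (ℤT.tate A B) ∣ ≡ ∣ A ∣ ^ 5 * ∣ B ∣ ^ 5 * ∣ TateInvariants.Q A B ∣
∣Δ-tate∣ A B = trans (cong ∣_∣ (Δ-tate A B)) (trans (ℤₚ.abs-* (a⁵b⁵ A B) (Q A B))
  (cong (_* ∣ Q A B ∣) (trans (ℤₚ.abs-* (fifth A) (fifth B)) (cong₂ _*_ (abs-^5 A) (abs-^5 B)))))
  where
  open TateInvariants
  fifth : ℤ → ℤ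
  fifth x = x ℤ.* x ℤ.* x ℤ.* x ℤ.* x

-- Distribution of the two primes among A, B and Q

module _ (A B : ℤ) (coprime : Coprime ∣ A ∣ ∣ B ∣) where
  open TateInvariants using (Q)
  private
    a = ∣ A ∣
    b = ∣ B ∣
    c = ∣ Q A B ∣
    D = a ^ 5 * b ^ 5 * c

  prime∣^5 : ∀ {ℓ} n → Prime ℓ → ℓ ∣ n ^ 5 → ℓ ∣ n
  prime∣^5 n ℓr d = ∣base 5 d
    where
    ∣base : ∀ k → _ ∣ n ^ k → _ ∣ n
    ∣base zero    d = contradiction d (prime∣1⇒⊥ ℓr)
    ∣base (suc k) d = [ id , ∣base k ]′ (euclidsLemma n (n ^ k) ℓr d)

  locate : ∀ {ℓ} → Prime ℓ → ℓ ∣ D → (ℓ ∣ a) ⊎ (ℓ ∣ b) ⊎ (ℓ ∣ c)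
  locate ℓr d = [ [ inj₁ ∘ prime∣^5 a ℓr , inj₂ ∘ inj₁ ∘ prime∣^5 b ℓr ]′ ∘ euclidsLemma (a ^ 5) (b ^ 5) ℓr
                , inj₂ ∘ inj₂ ]′ (euclidsLemma (a ^ 5 * b ^ 5) c ℓr d)

  module _ {ℓ : ℕ} (ℓr : Prime ℓ) where
    a∤b : ℓ ∣ a → ¬ ℓ ∣ b
    a∤b = coprime-prime ℓr coprime

    a∤c : ℓ ∣ a → ¬ ℓ ∣ c
    a∤c ℓ∣a ℓ∣c = TateInvariants.∣A⇒∤Q A B coprime ℓr (ℤS.∣ᵤ⇒∣ ℓ∣a) (ℤS.∣ᵤ⇒∣ ℓ∣c)

    b∤c : ℓ ∣ b → ¬ ℓ ∣ c
    b∤c ℓ∣b ℓ∣c = TateInvariants.∣B⇒∤Q A B coprime ℓr (ℤS.∣ᵤ⇒∣ ℓ∣b) (ℤS.∣ᵤ⇒∣ ℓ∣c)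

    b∤a : ℓ ∣ b → ¬ ℓ ∣ a
    b∤a ℓ∣b ℓ∣a = a∤b ℓ∣a ℓ∣b

    c∤a : ℓ ∣ c → ¬ ℓ ∣ a
    c∤a ℓ∣c ℓ∣a = a∤c ℓ∣a ℓ∣c

    c∤b : ℓ ∣ c → ¬ ℓ ∣ b
    c∤b ℓ∣c ℓ∣b = b∤c ℓ∣b ℓ∣c

  module _ (D≢0 : D ≢ 0) where
    A≢0 : A ≢ ℤ.0ℤ
    A≢0 eq = D≢0 (cong (λ x → ∣ x ∣ ^ 5 * b ^ 5 * c) eq)

    B≢0 : B ≢ ℤ.0ℤ
    B≢0 eq = D≢0 (cong (_* c) (trans (cong (λ x → a ^ 5 * ∣ x ∣ ^ 5) eq) (ℕₚ.*-zeroʳ (a ^ 5))))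

    -- As a, b, c share no primes, each bad prime divides exactly one of them. The order of p and q
    -- is fixed here; `classify` instantiates the module in both orders.
    module Located {p q : ℕ} (pr : Prime p) (qr : Prime q) (p≢q : p ≢ q)
                   (only : ∀ {ℓ} → Prime ℓ → ℓ ∣ D → ℓ ≡ p ⊎ ℓ ≡ q) where
      open Classification pr qr p≢q

      only-a : OnlyPrimes a
      only-a ℓr d = only ℓr (∣m⇒∣m*n c (∣m⇒∣m*n (b ^ 5) (∣m⇒∣m*n (a ^ 4) d)))

      only-b : OnlyPrimes b
      only-b ℓr d = only ℓr (∣m⇒∣m*n c (∣n⇒∣m*n (a ^ 5) (∣m⇒∣m*n (b ^ 4) d)))

      only-c : OnlyPrimes c
      only-c ℓr d = only ℓr (∣n⇒∣m*n (a ^ 5 * b ^ 5) d)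

      both-a : p ∣ a → ¬ q ∣ a
      both-a p∣a q∣a = units-BQ A B A≢0 (unit only-b (a∤b pr p∣a) (a∤b qr q∣a))
        (unit only-c (a∤c pr p∣a) (a∤c qr q∣a)) p∣a q∣a

      both-b : p ∣ b → ¬ q ∣ b
      both-b p∣b q∣b = units-BQ (ℤ.- B) A (λ eq → B≢0 (ℤₚ.neg-injective eq))
        (unit only-a (b∤a pr p∣b) (b∤a qr q∣b))
        (trans (Q-swap A B) (unit only-c (b∤c pr p∣b) (b∤c qr q∣b)))
        (subst (p ∣_) (sym (ℤₚ.∣-i∣≡∣i∣ B)) p∣b) (subst (q ∣_) (sym (ℤₚ.∣-i∣≡∣i∣ B)) q∣b)

      both-c : p ∣ c → ¬ q ∣ c
      both-c p∣c q∣c = not-both-11 p∣c q∣c (∣Q∣-units A B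
        (unit only-a (c∤a pr p∣c) (c∤a qr q∣c)) (unit only-b (c∤b pr p∣c) (c∤b qr q∣c)))

      p-in-a-q-in-b : p ∣ a → q ∣ b → DiscriminantShape p q D ⊎ DiscriminantShape q p D
      p-in-a-q-in-b p∣a q∣b =
        let i , a≡ = p-power only-a (b∤a qr q∣b)
            j , b≡ = q-power only-b (a∤b pr p∣a)
        in two-powers A B i j a≡ b≡ p∣a q∣b (unit only-c (a∤c pr p∣a) (b∤c qr q∣b))

      p-in-a-q-in-c : p ∣ a → q ∣ c → DiscriminantShape p q D
      p-in-a-q-in-c p∣a q∣c =
        let i , a≡ = p-power only-a (c∤a qr q∣c)
            j , c≡ = q-power only-c (a∤c pr p∣a)
        in unit-B A B {i} {j} (unit only-b (a∤b pr p∣a) (c∤b qr q∣c)) a≡ c≡ q∣c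

      p-in-b-q-in-c : p ∣ b → q ∣ c → DiscriminantShape p q D
      p-in-b-q-in-c p∣b q∣c =
        let i , b≡ = p-power only-b (c∤b qr q∣c)
            j , c≡ = q-power only-c (b∤c pr p∣b)
        -- The substitution (A , B) ↦ (- B , A) moves the unit A into the second place.
        in subst (DiscriminantShape p q)
             (cong₂ _*_ (trans (cong (λ x → x ^ 5 * a ^ 5) (ℤₚ.∣-i∣≡∣i∣ B)) (ℕₚ.*-comm (b ^ 5) (a ^ 5))) (Q-swap A B))
             (unit-B (ℤ.- B) A {i} {j} (unit only-a (b∤a pr p∣b) (c∤a qr q∣c))
               (trans (ℤₚ.∣-i∣≡∣i∣ B) b≡) (trans (Q-swap A B) c≡)
               (subst (q ∣_) (sym (Q-swap A B)) q∣c))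

    classify : ∀ {p q} → Prime p → Prime q → p ≢ q →
               (∀ {ℓ} → Prime ℓ → ℓ ∣ D → ℓ ≡ p ⊎ ℓ ≡ q) → p ∣ D → q ∣ D →
               DiscriminantShape p q D ⊎ DiscriminantShape q p D
    classify {p} {q} pr qr p≢q only p∣D q∣D = cases (locate pr p∣D) (locate qr q∣D)
      where
      module PQ = Located pr qr p≢q only
      module QP = Located qr pr (p≢q ∘ sym) (λ ℓr d → ⊎.swap (only ℓr d))
      cases : (p ∣ a) ⊎ (p ∣ b) ⊎ (p ∣ c) → (q ∣ a) ⊎ (q ∣ b) ⊎ (q ∣ c) → DiscriminantShape p q D ⊎ DiscriminantShape q p D
      cases (inj₁ pa)        (inj₁ qa)        = contradiction qa (PQ.both-a pa)
      cases (inj₁ pa)        (inj₂ (inj₁ qb)) = PQ.p-in-a-q-in-b pa qb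
      cases (inj₁ pa)        (inj₂ (inj₂ qc)) = inj₁ (PQ.p-in-a-q-in-c pa qc)
      cases (inj₂ (inj₁ pb)) (inj₁ qa)        = ⊎.swap (QP.p-in-a-q-in-b qa pb)
      cases (inj₂ (inj₁ pb)) (inj₂ (inj₁ qb)) = contradiction qb (PQ.both-b pb)
      cases (inj₂ (inj₁ pb)) (inj₂ (inj₂ qc)) = inj₁ (PQ.p-in-b-q-in-c pb qc)
      cases (inj₂ (inj₂ pc)) (inj₁ qa)        = inj₂ (QP.p-in-a-q-in-c qa pc)
      cases (inj₂ (inj₂ pc)) (inj₂ (inj₁ qb)) = inj₂ (QP.p-in-b-q-in-c qb pc)
      cases (inj₂ (inj₂ pc)) (inj₂ (inj₂ qc)) = contradiction qc (PQ.both-c pc)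

-- Conductor, minimal discriminant and conclusion

conductor-prime : ∀ {p W f N} → ConductorExponent p W f → N hasValuation f at p →
                  (p ∣ N → p ∣ ∣ ℤW.Δ W ∣) × (p ∣ ∣ ℤW.Δ W ∣ → p ∣ N)
conductor-prime {p} {N = N} (good p∤Δ) (_ , p∤N) =
  (λ p∣N → contradiction (subst (_∣ N) (sym (ℕₚ.*-identityʳ p)) p∣N) p∤N) , (λ p∣Δ → contradiction p∣Δ p∤Δ)
conductor-prime {p} (multiplicative p∣Δ _) (pᶠ∣N , _) = (λ _ → p∣Δ) , (λ _ → ∣-trans (m∣m*n 1) pᶠ∣N)
conductor-prime {p} (additive _ δ p∣Δ _ _ _) (pᶠ∣N , _) = (λ _ → p∣Δ) , (λ _ → ∣-trans (m∣m*n (p ^ suc δ)) pᶠ∣N)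

integral-Δ≢0 : ∀ E V → IntegralModel E V → ∣ ℤW.Δ V ∣ ≢ 0
integral-Δ≢0 E V E≅V ∣Δ∣≡0 =
  let u , _ , _ , Δ≡ = ≅-invariants (EllipticCurve.equation E) V E≅V
  in EllipticCurve.nonsingular E (trans (sym Δ≡)
       (trans (cong (λ d → pow₁₂ u ℚ.* ι d) (ℤₚ.∣i∣≡0⇒i≡0 {ℤW.Δ V} ∣Δ∣≡0)) (ℚₚ.*-zeroʳ (pow₁₂ u))))

theorem3p3 : (E : EllipticCurve) →
    NontrivialTorsion E 5 →
    (N : ℕ) → IsConductor E N →
    (p q α β : ℕ) → Prime p → Prime q → p ≢ q → 0 < α → 0 < β →
    N ≡ p ^ α * q ^ β →
    (D : ℤ) → IsMinimalDiscriminant E D →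
    DiscriminantShape p q ∣ D ∣ ⊎ DiscriminantShape q p ∣ D ∣
theorem3p3 E torsion N (W , W-minimal , exponents) p q (suc α) (suc β) pr qr p≢q _ _ N≡ D (V , V-minimal , refl) =
  shape (5-torsion⇒tate-model E torsion)
  where
  divisors : ∀ {ℓ} → Prime ℓ → ℓ ∣ N → ℓ ≡ p ⊎ ℓ ≡ q
  divisors {ℓ} ℓr d = [ inj₁ ∘ prime-∣-^ (suc α) ℓr pr , inj₂ ∘ prime-∣-^ (suc β) ℓr qr ]′
    (euclidsLemma (p ^ suc α) (q ^ suc β) ℓr (subst (ℓ ∣_) N≡ d))

  p∣N : p ∣ N
  p∣N = subst (p ∣_) (sym N≡) (∣m⇒∣m*n (q ^ suc β) (m∣m*n (p ^ α)))

  q∣N : q ∣ N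
  q∣N = subst (q ∣_) (sym N≡) (∣n⇒∣m*n (p ^ suc α) (m∣m*n (q ^ β)))

  bad : ∀ {ℓ} → Prime ℓ → (ℓ ∣ N → ℓ ∣ ∣ ℤW.Δ W ∣) × (ℓ ∣ ∣ ℤW.Δ W ∣ → ℓ ∣ N)
  bad {ℓ} ℓr = let _ , exponent , valuation = exponents ℓ ℓr in
    conductor-prime {W = W} exponent valuation

  shape : (∃[ A ] ∃[ B ] Coprime ∣ A ∣ ∣ B ∣ × IntegralModel E (ℤT.tate A B)) →
          DiscriminantShape p q ∣ ℤW.Δ V ∣ ⊎ DiscriminantShape q p ∣ ℤW.Δ V ∣
  shape (A , B , coprime , T-model) =
    subst (λ d → DiscriminantShape p q d ⊎ DiscriminantShape q p d) (sym (∣Δ∣≡ V V-minimal))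
      (classify A B coprime (subst (_≢ 0) (∣Δ-tate∣ A B) (integral-Δ≢0 E (ℤT.tate A B) T-model)) pr qr p≢q
        (λ {ℓ} ℓr d → divisors ℓr (proj₂ (bad ℓr) (subst (ℓ ∣_) (sym (∣Δ∣≡ W W-minimal)) d)))
        (subst (p ∣_) (∣Δ∣≡ W W-minimal) (proj₁ (bad pr) p∣N))
        (subst (q ∣_) (∣Δ∣≡ W W-minimal) (proj₁ (bad qr) q∣N)))
    where
    -- The conductor and the discriminant come with possibly different minimal models W and V; both
    -- have the discriminant of the Tate model up to sign.
    ∣Δ∣≡ : ∀ V → IsMinimalModel E V → ∣ ℤW.Δ V ∣ ≡ ∣ A ∣ ^ 5 * ∣ B ∣ ^ 5 * ∣ TateInvariants.Q A B ∣
    ∣Δ∣≡ V V-minimal = trans (tate-minimal E A B coprime T-model V V-minimal) (∣Δ-tate∣ A B)
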